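{- Let $G$ be a tree with vertex set $V$. Then \[R(G)\geq 1+\sum_{v\in V}\left(\sqrt{d_v}-1\right),\] with equality if $G$ is a star.
   Context: $d_v$ is the degree of vertex $v$; the Randi\'c index is $R(G)=\sum_{uv\in E(G)}\frac{1}{\sqrt{d_ud_v}}$ (equal to $0$ for a single vertex). A star is a tree with one vertex adjacent to all others. -}

module Defs where

open import Data.Fin.Base as Fin using (Fin)
import Data.Fin.Properties as Fin
open import Data.Integer.Base as ℤ using (+_; +[1+_])
import Data.Integer.Properties as ℤ
open import Data.List.Base
  using (List; _∷_; _∷ʳ_; length; map; foldr; filter; allFin; cartesianProduct)
open import Data.List.Relation.Unary.Linked using (Linked)
open import Data.List.Relation.Unary.Unique.Propositional using (Unique)
open import Data.Nat.Base as ℕ using (ℕ; zero; suc; s≤s; z≤n)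
import Data.Nat.Properties as ℕ
open import Data.Nat.Solver using (module +-*-Solver)
open import Data.Product.Base using (∃; _×_; _,_)
open import Data.Rational.Base as ℚ using (ℚ; mkℚ; 0ℚ; 1ℚ; ½; ∣_∣)
import Data.Rational.Properties as ℚ
import Data.Rational.Solver as ℚ
import Data.Rational.Unnormalised.Base as ℚᵘ
import Data.Rational.Unnormalised.Properties as ℚᵘ
open import Data.Sum.Base using (inj₁; inj₂)
open import Level using (0ℓ)
open import Relation.Binary.Construct.Closure.ReflexiveTransitive using (Star)
open import Relation.Binary.Core using (Rel)
open import Relation.Binary.Definitions using (Decidable; Symmetric; Irreflexive)
open import Relation.Binary.PropositionalEquality
  using (_≡_; _≢_; refl; sym; trans; cong; cong₂; subst; subst₂)
open import Relation.Nullary using (¬_; yes; no; contradiction)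
open import Relation.Nullary.Decidable using (_×-dec_)

module ℚ-Lemmas where
  ½+½ : ∀ ε → ½ ℚ.* ε ℚ.+ ½ ℚ.* ε ≡ ε
  ½+½ ε = trans (sym (ℚ.*-distribʳ-+ ε ½ ½)) (ℚ.*-identityˡ ε)

  *-pos : ∀ {p q} → 0ℚ ℚ.< p → 0ℚ ℚ.< q → 0ℚ ℚ.< p ℚ.* q
  *-pos {p} {q} 0<p 0<q = ℚ.positive⁻¹ _
    {{ℚ.pos*pos⇒pos p {{ℚ.positive 0<p}} q {{ℚ.positive 0<q}}}}

  0<½* : ∀ {ε} → 0ℚ ℚ.< ε → 0ℚ ℚ.< ½ ℚ.* ε
  0<½* = *-pos (ℚ.positive⁻¹ ½)

  *-mono-≤ : ∀ {p q r s} → 0ℚ ℚ.≤ p → 0ℚ ℚ.≤ s → p ℚ.≤ q → r ℚ.≤ s →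
             p ℚ.* r ℚ.≤ q ℚ.* s
  *-mono-≤ {p} {q} {r} {s} 0≤p 0≤s p≤q r≤s = ℚ.≤-trans
    (ℚ.*-monoˡ-≤-nonNeg p {{ℚ.nonNegative 0≤p}} r≤s)
    (ℚ.*-monoʳ-≤-nonNeg s {{ℚ.nonNegative 0≤s}} p≤q)

  ∣p-q∣≡∣q-p∣ : ∀ p q → ∣ p ℚ.- q ∣ ≡ ∣ q ℚ.- p ∣
  ∣p-q∣≡∣q-p∣ p q = trans (sym (ℚ.∣-p∣≡∣p∣ (p ℚ.- q)))
    (cong ∣_∣ (solve 2 (λ x y → :- (x :- y) := y :- x) refl p q))
    where open ℚ.+-*-Solver

  shift : ∀ {p q ε} → p ℚ.≤ q ℚ.+ ε → p ℚ.- q ℚ.≤ ε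
  shift {p} {q} {ε} h = subst (p ℚ.- q ℚ.≤_)
    (solve 2 (λ y e → (y :+ e) :- y := e) refl q ε) (ℚ.+-monoˡ-≤ (ℚ.- q) h)
    where open ℚ.+-*-Solver

  ∣p-q∣≤ : ∀ {p q ε} → p ℚ.≤ q ℚ.+ ε → q ℚ.≤ p ℚ.+ ε → ∣ p ℚ.- q ∣ ℚ.≤ ε
  ∣p-q∣≤ {p} {q} p≤ q≤ with ℚ.∣p∣≡p∨∣p∣≡-p (p ℚ.- q)
  ... | inj₁ eq = ℚ.≤-trans (ℚ.≤-reflexive eq) (shift p≤)
  ... | inj₂ eq = ℚ.≤-trans (ℚ.≤-reflexive (trans eq
          (solve 2 (λ x y → :- (x :- y) := y :- x) refl p q))) (shift q≤)
    where open ℚ.+-*-Solver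

  recip : ℚ → ℚ
  recip p with p ℚ.≟ 0ℚ
  ... | yes _   = 0ℚ
  ... | no p≢0 = ℚ.1/_ p {{ℚ.≢-nonZero p≢0}}

  *-recip : ∀ {p} → 0ℚ ℚ.< p → p ℚ.* recip p ≡ 1ℚ
  *-recip {p} 0<p with p ℚ.≟ 0ℚ
  ... | yes refl = contradiction refl (ℚ.<⇒≢ 0<p)
  ... | no p≢0  = ℚ.*-inverseʳ p {{ℚ.≢-nonZero p≢0}}

  recip-pos : ∀ {p} → 0ℚ ℚ.< p → 0ℚ ℚ.< recip p
  recip-pos {p} 0<p with p ℚ.≟ 0ℚ
  ... | yes refl = contradiction refl (ℚ.<⇒≢ 0<p)
  ... | no p≢0  = ℚ.positive⁻¹ _ {{ℚ.1/pos⇒pos p {{ℚ.positive 0<p}}}}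

  recip-anti : ∀ {p q} → 0ℚ ℚ.< p → p ℚ.≤ q → recip q ℚ.≤ recip p
  recip-anti {p} {q} 0<p p≤q = subst₂ ℚ._≤_
    (trans (solve 3 (λ x r s → x :* (r :* s) := (x :* r) :* s) refl
              p (recip p) (recip q))
      (trans (cong (ℚ._* recip q) (*-recip 0<p)) (ℚ.*-identityˡ _)))
    (trans (solve 3 (λ y r s → y :* (r :* s) := (y :* s) :* r) refl
              q (recip p) (recip q))
      (trans (cong (ℚ._* recip p) (*-recip 0<q)) (ℚ.*-identityˡ _)))
    (ℚ.*-monoʳ-≤-nonNeg (recip p ℚ.* recip q)
      {{ℚ.nonNegative (ℚ.<⇒≤ (*-pos (recip-pos 0<p) (recip-pos 0<q)))}} p≤q)
    where
    open ℚ.+-*-Solver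
    0<q = ℚ.<-≤-trans 0<p p≤q

  recip-diff : ∀ {p q} → 0ℚ ℚ.< p → 0ℚ ℚ.< q →
    recip p ℚ.- recip q ≡ (recip p ℚ.* recip q) ℚ.* (q ℚ.- p)
  recip-diff {p} {q} 0<p 0<q = sym (trans
    (solve 4 (λ x y r s → (r :* s) :* (y :- x) := r :* (y :* s) :- (x :* r) :* s)
       refl p q (recip p) (recip q))
    (cong₂ (λ u v → u ℚ.- v)
      (trans (cong (recip p ℚ.*_) (*-recip 0<q)) (ℚ.*-identityʳ (recip p)))
      (trans (cong (ℚ._* recip q) (*-recip 0<p)) (ℚ.*-identityˡ (recip q)))))
    where open ℚ.+-*-Solver

open ℚ-Lemmas

-- Real numbers as Cauchy sequences of rationals with a modulus, taken up
-- to the equivalence _≈_.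

record ℝ : Set where
  constructor mkℝ
  field
    seq    : ℕ → ℚ
    cauchy : ∀ ε → 0ℚ ℚ.< ε → ∃ λ N → ∀ i j → N ℕ.≤ i → N ℕ.≤ j →
             ∣ seq i ℚ.- seq j ∣ ℚ.≤ ε

open ℝ public

infix 4 _≈_ _≤_ _≥_
infixl 6 _+_ _-_
infixl 7 _*_
infix 8 -_

record _≈_ (x y : ℝ) : Set where
  constructor mk≈
  field
    near : ∀ ε → 0ℚ ℚ.< ε → ∃ λ N → ∀ i → N ℕ.≤ i →
           ∣ seq x i ℚ.- seq y i ∣ ℚ.≤ ε

record _≤_ (x y : ℝ) : Set where
  constructor mk≤
  field
    below : ∀ ε → 0ℚ ℚ.< ε → ∃ λ N → ∀ i → N ℕ.≤ i →
            seq x i ℚ.≤ seq y i ℚ.+ ε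

_≥_ : ℝ → ℝ → Set
x ≥ y = y ≤ x

record Positive (x : ℝ) : Set where
  constructor mkPos
  field
    bound   : ℚ
    0<bound : 0ℚ ℚ.< bound
    from    : ℕ
    above   : ∀ i → from ℕ.≤ i → bound ℚ.≤ seq x i

fromℚ : ℚ → ℝ
fromℚ q = mkℝ (λ _ → q) λ ε 0<ε → 0 , λ _ _ _ _ →
  ℚ.≤-trans (ℚ.≤-reflexive (cong ∣_∣ (ℚ.+-inverseʳ q))) (ℚ.<⇒≤ 0<ε)

fromℕ : ℕ → ℝ
fromℕ m = fromℚ (+ m ℚ./ 1)

0ℝ 1ℝ : ℝ
0ℝ = fromℚ 0ℚ
1ℝ = fromℚ 1ℚ

_+_ : ℝ → ℝ → ℝ
x + y = mkℝ (λ i → seq x i ℚ.+ seq y i) λ ε 0<ε →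
  let M , p = cauchy x (½ ℚ.* ε) (0<½* 0<ε)
      N , q = cauchy y (½ ℚ.* ε) (0<½* 0<ε)
  in M ℕ.⊔ N , λ i j h k → begin
    ∣ (seq x i ℚ.+ seq y i) ℚ.- (seq x j ℚ.+ seq y j) ∣
      ≡⟨ cong ∣_∣ (rearrange (seq x i) (seq y i) (seq x j) (seq y j)) ⟩
    ∣ (seq x i ℚ.- seq x j) ℚ.+ (seq y i ℚ.- seq y j) ∣
      ≤⟨ ℚ.∣p+q∣≤∣p∣+∣q∣ (seq x i ℚ.- seq x j) (seq y i ℚ.- seq y j) ⟩
    ∣ seq x i ℚ.- seq x j ∣ ℚ.+ ∣ seq y i ℚ.- seq y j ∣
      ≤⟨ ℚ.+-mono-≤ (p i j (ℕ.m⊔n≤o⇒m≤o M N h) (ℕ.m⊔n≤o⇒m≤o M N k))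
                    (q i j (ℕ.m⊔n≤o⇒n≤o M N h) (ℕ.m⊔n≤o⇒n≤o M N k)) ⟩
    ½ ℚ.* ε ℚ.+ ½ ℚ.* ε ≡⟨ ½+½ ε ⟩
    ε ∎
  where
  open ℚ.≤-Reasoning
  rearrange : ∀ a b c d → (a ℚ.+ b) ℚ.- (c ℚ.+ d) ≡ (a ℚ.- c) ℚ.+ (b ℚ.- d)
  rearrange = solve 4 (λ a b c d → (a :+ b) :- (c :+ d) := (a :- c) :+ (b :- d)) refl
    where open ℚ.+-*-Solver

-_ : ℝ → ℝ
- x = mkℝ (λ i → ℚ.- seq x i) λ ε 0<ε →
  let N , p = cauchy x ε 0<ε
  in N , λ i j h k → ℚ.≤-trans (ℚ.≤-reflexive
       (trans (cong ∣_∣ (solve 2 (λ a b → (:- a) :- (:- b) := b :- a) refl (seq x i) (seq x j)))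
              (∣p-q∣≡∣q-p∣ (seq x j) (seq x i)))) (p i j h k)
  where open ℚ.+-*-Solver

_-_ : ℝ → ℝ → ℝ
x - y = x + (- y)

seq-bounded : ∀ x → ∃ λ B → 0ℚ ℚ.< B × ∃ λ N → ∀ i → N ℕ.≤ i → ∣ seq x i ∣ ℚ.≤ B
seq-bounded x with cauchy x 1ℚ (ℚ.positive⁻¹ 1ℚ)
... | N , p = ∣ seq x N ∣ ℚ.+ 1ℚ
            , ℚ.+-mono-≤-< (ℚ.0≤∣p∣ (seq x N)) (ℚ.positive⁻¹ 1ℚ)
            , N , λ i h → begin
  ∣ seq x i ∣
    ≡⟨ cong ∣_∣ (solve 2 (λ a b → a := b :+ (a :- b)) refl (seq x i) (seq x N)) ⟩
  ∣ seq x N ℚ.+ (seq x i ℚ.- seq x N) ∣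
    ≤⟨ ℚ.∣p+q∣≤∣p∣+∣q∣ (seq x N) (seq x i ℚ.- seq x N) ⟩
  ∣ seq x N ∣ ℚ.+ ∣ seq x i ℚ.- seq x N ∣
    ≤⟨ ℚ.+-monoʳ-≤ ∣ seq x N ∣ (p i N h ℕ.≤-refl) ⟩
  ∣ seq x N ∣ ℚ.+ 1ℚ ∎
  where
  open ℚ.≤-Reasoning
  open ℚ.+-*-Solver using (solve; _:=_; _:+_; _:-_)

_*_ : ℝ → ℝ → ℝ
x * y = mkℝ (λ i → seq x i ℚ.* seq y i) λ ε 0<ε →
  let B , 0<B , Nx , bx = seq-bounded x
      C , 0<C , Ny , by = seq-bounded y
      M , p = cauchy x (recip C ℚ.* (½ ℚ.* ε)) (*-pos (recip-pos 0<C) (0<½* 0<ε))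
      N , q = cauchy y (recip B ℚ.* (½ ℚ.* ε)) (*-pos (recip-pos 0<B) (0<½* 0<ε))
  in (Nx ℕ.⊔ Ny) ℕ.⊔ (M ℕ.⊔ N) , λ i j h k →
    let xi = seq x i ; xj = seq x j ; yi = seq y i ; yj = seq y j
        hB = ℕ.m⊔n≤o⇒m≤o Nx Ny (ℕ.m⊔n≤o⇒m≤o (Nx ℕ.⊔ Ny) (M ℕ.⊔ N) h)
        kC = ℕ.m⊔n≤o⇒n≤o Nx Ny (ℕ.m⊔n≤o⇒m≤o (Nx ℕ.⊔ Ny) (M ℕ.⊔ N) k)
        h′ = ℕ.m⊔n≤o⇒n≤o (Nx ℕ.⊔ Ny) (M ℕ.⊔ N) h
        k′ = ℕ.m⊔n≤o⇒n≤o (Nx ℕ.⊔ Ny) (M ℕ.⊔ N) k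
    in begin
    ∣ xi ℚ.* yi ℚ.- xj ℚ.* yj ∣
      ≡⟨ cong ∣_∣ (rearrange xi yi xj yj) ⟩
    ∣ yj ℚ.* (xi ℚ.- xj) ℚ.+ xi ℚ.* (yi ℚ.- yj) ∣
      ≤⟨ ℚ.∣p+q∣≤∣p∣+∣q∣ (yj ℚ.* (xi ℚ.- xj)) (xi ℚ.* (yi ℚ.- yj)) ⟩
    ∣ yj ℚ.* (xi ℚ.- xj) ∣ ℚ.+ ∣ xi ℚ.* (yi ℚ.- yj) ∣
      ≡⟨ cong₂ ℚ._+_ (ℚ.∣p*q∣≡∣p∣*∣q∣ yj (xi ℚ.- xj)) (ℚ.∣p*q∣≡∣p∣*∣q∣ xi (yi ℚ.- yj)) ⟩
    ∣ yj ∣ ℚ.* ∣ xi ℚ.- xj ∣ ℚ.+ ∣ xi ∣ ℚ.* ∣ yi ℚ.- yj ∣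
      ≤⟨ ℚ.+-mono-≤
           (*-mono-≤ (ℚ.0≤∣p∣ yj) (ℚ.<⇒≤ (*-pos (recip-pos 0<C) (0<½* 0<ε))) (by j kC)
             (p i j (ℕ.m⊔n≤o⇒m≤o M N h′) (ℕ.m⊔n≤o⇒m≤o M N k′)))
           (*-mono-≤ (ℚ.0≤∣p∣ xi) (ℚ.<⇒≤ (*-pos (recip-pos 0<B) (0<½* 0<ε))) (bx i hB)
             (q i j (ℕ.m⊔n≤o⇒n≤o M N h′) (ℕ.m⊔n≤o⇒n≤o M N k′))) ⟩
    C ℚ.* (recip C ℚ.* (½ ℚ.* ε)) ℚ.+ B ℚ.* (recip B ℚ.* (½ ℚ.* ε))
      ≡⟨ cong₂ ℚ._+_ (cancel 0<C) (cancel 0<B) ⟩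
    ½ ℚ.* ε ℚ.+ ½ ℚ.* ε ≡⟨ ½+½ ε ⟩
    ε ∎
  where
  open ℚ.≤-Reasoning
  rearrange : ∀ a b c d → a ℚ.* b ℚ.- c ℚ.* d ≡ d ℚ.* (a ℚ.- c) ℚ.+ a ℚ.* (b ℚ.- d)
  rearrange = solve 4 (λ a b c d → a :* b :- c :* d := d :* (a :- c) :+ a :* (b :- d)) refl
    where open ℚ.+-*-Solver
  cancel : ∀ {c δ} → 0ℚ ℚ.< c → c ℚ.* (recip c ℚ.* δ) ≡ δ
  cancel {c} {δ} 0<c = trans (sym (ℚ.*-assoc c (recip c) δ))
    (trans (cong (ℚ._* δ) (*-recip 0<c)) (ℚ.*-identityˡ δ))

-- The finitely many zero terms the sequence may have are sent to 0 by recip.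
inverse : (x : ℝ) → Positive x → ℝ
inverse x (mkPos b 0<b K above) = mkℝ (λ i → recip (seq x i)) λ ε 0<ε →
  let 0<bb = *-pos 0<b 0<b
      N , p = cauchy x ((b ℚ.* b) ℚ.* ε) (*-pos 0<bb 0<ε)
  in K ℕ.⊔ N , λ i j h k →
    let xi = seq x i ; xj = seq x j
        b≤i = above i (ℕ.m⊔n≤o⇒m≤o K N h)
        b≤j = above j (ℕ.m⊔n≤o⇒m≤o K N k)
        0<i = ℚ.<-≤-trans 0<b b≤i
        0<j = ℚ.<-≤-trans 0<b b≤j
        0≤rr = ℚ.<⇒≤ (*-pos (recip-pos 0<i) (recip-pos 0<j))
    in begin
    ∣ recip xi ℚ.- recip xj ∣
      ≡⟨ cong ∣_∣ (recip-diff 0<i 0<j) ⟩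
    ∣ (recip xi ℚ.* recip xj) ℚ.* (xj ℚ.- xi) ∣
      ≡⟨ ℚ.∣p*q∣≡∣p∣*∣q∣ (recip xi ℚ.* recip xj) (xj ℚ.- xi) ⟩
    ∣ recip xi ℚ.* recip xj ∣ ℚ.* ∣ xj ℚ.- xi ∣
      ≡⟨ cong (ℚ._* ∣ xj ℚ.- xi ∣) (ℚ.0≤p⇒∣p∣≡p 0≤rr) ⟩
    (recip xi ℚ.* recip xj) ℚ.* ∣ xj ℚ.- xi ∣
      ≤⟨ *-mono-≤ 0≤rr (ℚ.<⇒≤ (*-pos 0<bb 0<ε))
           (*-mono-≤ (ℚ.<⇒≤ (recip-pos 0<i)) (ℚ.<⇒≤ (recip-pos 0<b))
             (recip-anti 0<b b≤i) (recip-anti 0<b b≤j))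
           (p j i (ℕ.m⊔n≤o⇒n≤o K N k) (ℕ.m⊔n≤o⇒n≤o K N h)) ⟩
    (recip b ℚ.* recip b) ℚ.* ((b ℚ.* b) ℚ.* ε)
      ≡⟨ solve 3 (λ c r e → (r :* r) :* ((c :* c) :* e) := (c :* r) :* ((c :* r) :* e))
           refl b (recip b) ε ⟩
    (b ℚ.* recip b) ℚ.* ((b ℚ.* recip b) ℚ.* ε)
      ≡⟨ cong (λ t → t ℚ.* (t ℚ.* ε)) (*-recip 0<b) ⟩
    1ℚ ℚ.* (1ℚ ℚ.* ε)
      ≡⟨ trans (ℚ.*-identityˡ _) (ℚ.*-identityˡ ε) ⟩
    ε ∎
  where
  open ℚ.≤-Reasoning
  open ℚ.+-*-Solver using (solve; _:=_; _:*_)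

*-inverse : ∀ x (x>0 : Positive x) → x * inverse x x>0 ≈ 1ℝ
*-inverse x (mkPos b 0<b K above) = mk≈ λ ε 0<ε → K , λ i h →
  ℚ.≤-trans
    (ℚ.≤-reflexive (cong (λ t → ∣ t ℚ.- 1ℚ ∣)
      (*-recip (ℚ.<-≤-trans 0<b (above i h)))))
    (ℚ.<⇒≤ 0<ε)

sumℝ : List ℝ → ℝ
sumℝ = foldr _+_ 0ℝ

isqrt : ℕ → ℕ
isqrt zero    = 0
isqrt (suc m) with suc (isqrt m) ℕ.* suc (isqrt m) ℕ.≤? suc m
... | yes _ = suc (isqrt m)
... | no  _ = isqrt m

isqrt-lower : ∀ m → isqrt m ℕ.* isqrt m ℕ.≤ m
isqrt-lower zero    = z≤n
isqrt-lower (suc m) with suc (isqrt m) ℕ.* suc (isqrt m) ℕ.≤? suc m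
... | yes p = p
... | no  _ = ℕ.m≤n⇒m≤1+n (isqrt-lower m)

isqrt-upper : ∀ m → m ℕ.< suc (isqrt m) ℕ.* suc (isqrt m)
isqrt-upper zero    = s≤s z≤n
isqrt-upper (suc m) with suc (isqrt m) ℕ.* suc (isqrt m) ℕ.≤? suc m
... | yes p = ℕ.≤-<-trans (isqrt-upper m)
                (ℕ.*-mono-< (ℕ.n<1+n (suc (isqrt m))) (ℕ.n<1+n (suc (isqrt m))))
... | no ¬p = ℕ.≰⇒> ¬p

-- ⌊√(m(i+1)²)⌋ / (i+1), within 1/(i+1) below √m.
√-seq : ℕ → ℕ → ℚ
√-seq m i = + isqrt (m ℕ.* (suc i ℕ.* suc i)) ℚ./ suc i

module /-Lemmas where
  /-mono : ∀ a b c d → a ℕ.* suc d ℕ.≤ c ℕ.* suc b → + a ℚ./ suc b ℚ.≤ + c ℚ./ suc d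
  /-mono a b c d h = ℚ.toℚᵘ-cancel-≤ (ℚᵘ.≤-respˡ-≃ (ℚᵘ.≃-sym (ℚ.toℚᵘ-fromℚᵘ (ℚᵘ.mkℚᵘ (+ a) b)))
    (ℚᵘ.≤-respʳ-≃ (ℚᵘ.≃-sym (ℚ.toℚᵘ-fromℚᵘ (ℚᵘ.mkℚᵘ (+ c) d)))
      (ℚᵘ.*≤* (subst₂ ℤ._≤_ (ℤ.pos-* a (suc d)) (ℤ.pos-* c (suc b)) (ℤ.+≤+ h)))))

  /-+ : ∀ a b d → (+ a ℚ./ suc d) ℚ.+ (+ b ℚ./ suc d) ≡ + (a ℕ.+ b) ℚ./ suc d
  /-+ a b d = ℚ.toℚᵘ-injective (ℚᵘ.≃-trans (ℚ.toℚᵘ-homo-+ (+ a ℚ./ suc d) (+ b ℚ./ suc d))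
    (ℚᵘ.≃-trans (ℚᵘ.+-cong (ℚ.toℚᵘ-fromℚᵘ (ℚᵘ.mkℚᵘ (+ a) d)) (ℚ.toℚᵘ-fromℚᵘ (ℚᵘ.mkℚᵘ (+ b) d)))
      (ℚᵘ.≃-trans (ℚᵘ.*≡* eq) (ℚᵘ.≃-sym (ℚ.toℚᵘ-fromℚᵘ (ℚᵘ.mkℚᵘ (+ (a ℕ.+ b)) d))))))
    where
    D = + suc d
    eq : (+ a ℤ.* D ℤ.+ + b ℤ.* D) ℤ.* D ≡ + (a ℕ.+ b) ℤ.* + (suc d ℕ.* suc d)
    eq = trans (cong (ℤ._* D) (sym (ℤ.*-distribʳ-+ D (+ a) (+ b))))
      (trans (ℤ.*-assoc (+ (a ℕ.+ b)) D D)
        (cong (+ (a ℕ.+ b) ℤ.*_) (sym (ℤ.pos-* (suc d) (suc d)))))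

  /-* : ∀ a b c d → (+ a ℚ./ suc b) ℚ.* (+ c ℚ./ suc d) ≡ + (a ℕ.* c) ℚ./ (suc b ℕ.* suc d)
  /-* a b c d = ℚ.toℚᵘ-injective (ℚᵘ.≃-trans (ℚ.toℚᵘ-homo-* (+ a ℚ./ suc b) (+ c ℚ./ suc d))
    (ℚᵘ.≃-trans (ℚᵘ.*-cong (ℚ.toℚᵘ-fromℚᵘ (ℚᵘ.mkℚᵘ (+ a) b)) (ℚ.toℚᵘ-fromℚᵘ (ℚᵘ.mkℚᵘ (+ c) d)))
      (ℚᵘ.≃-trans (ℚᵘ.*≡* (cong (ℤ._* + (suc b ℕ.* suc d)) (sym (ℤ.pos-* a c))))
        (ℚᵘ.≃-sym (ℚ.toℚᵘ-fromℚᵘ (ℚᵘ.mkℚᵘ (+ (a ℕ.* c)) (d ℕ.+ b ℕ.* suc d)))))))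

  archimedean : ∀ ε → 0ℚ ℚ.< ε → ∃ λ N → + 1 ℚ./ suc N ℚ.≤ ε
  archimedean ε@(mkℚ (+ zero) d _) 0<ε =
    contradiction (sym (ℚ.↥p≡0⇒p≡0 ε refl)) (ℚ.<⇒≢ 0<ε)
  archimedean ε@(mkℚ +[1+ p ] d _) 0<ε = d , subst (+ 1 ℚ./ suc d ℚ.≤_) (ℚ.↥p/↧p≡p ε)
    (/-mono 1 d (suc p) d (ℕ.*-monoˡ-≤ (suc d) {1} {suc p} (s≤s z≤n)))
  archimedean ε@(mkℚ ℤ.-[1+ p ] d _) 0<ε =
    contradiction 0<ε (ℚ.<-asym (ℚ.negative⁻¹ ε))

  sq-cancel-< : ∀ {a b} → a ℕ.* a ℕ.< b ℕ.* b → a ℕ.< b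
  sq-cancel-< {a} {b} h with a ℕ.<? b
  ... | yes p = p
  ... | no ¬p = contradiction h (ℕ.≤⇒≯ (ℕ.*-mono-≤ (ℕ.≮⇒≥ ¬p) (ℕ.≮⇒≥ ¬p)))

  √-close : ∀ m i j → √-seq m i ℚ.≤ √-seq m j ℚ.+ + 1 ℚ./ suc j
  √-close m i j = subst (√-seq m i ℚ.≤_) (sym (/-+ s 1 j))
    (/-mono r i (s ℕ.+ 1) j (ℕ.<⇒≤ (sq-cancel-< sq)))
    where
    k = suc i
    l = suc j
    r = isqrt (m ℕ.* (k ℕ.* k))
    s = isqrt (m ℕ.* (l ℕ.* l))
    open +-*-Solver
    sq : (r ℕ.* l) ℕ.* (r ℕ.* l) ℕ.< ((s ℕ.+ 1) ℕ.* k) ℕ.* ((s ℕ.+ 1) ℕ.* k)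
    sq = ℕ.≤-<-trans
      (subst₂ ℕ._≤_
        (solve 2 (λ r l → (r :* r) :* (l :* l) := (r :* l) :* (r :* l)) refl r l)
        (solve 3 (λ m k l → (m :* (k :* k)) :* (l :* l) := (m :* (l :* l)) :* (k :* k)) refl m k l)
        (ℕ.*-monoˡ-≤ (l ℕ.* l) (isqrt-lower (m ℕ.* (k ℕ.* k)))))
      (subst (m ℕ.* (l ℕ.* l) ℕ.* (k ℕ.* k) ℕ.<_)
        (solve 2 (λ s k → ((con 1 :+ s) :* (con 1 :+ s)) :* (k :* k)
                       := ((s :+ con 1) :* k) :* ((s :+ con 1) :* k)) refl s k)
        (ℕ.*-monoˡ-< (k ℕ.* k) (isqrt-upper (m ℕ.* (l ℕ.* l)))))

open /-Lemmas

infix 9 √_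

√_ : ℕ → ℝ
√ m = mkℝ (√-seq m) λ ε 0<ε →
  let N , h = archimedean ε 0<ε
      close : ∀ i j → N ℕ.≤ j → √-seq m i ℚ.≤ √-seq m j ℚ.+ ε
      close i j N≤j = ℚ.≤-trans (√-close m i j) (ℚ.+-monoʳ-≤ (√-seq m j)
        (ℚ.≤-trans (/-mono 1 j 1 N (ℕ.*-monoʳ-≤ 1 (s≤s N≤j))) h))
  in N , λ i j N≤i N≤j → ∣p-q∣≤ (close i j N≤j) (close j i N≤i)

√-nonneg : ∀ m → 0ℝ ≤ √ m
√-nonneg m = mk≤ λ ε 0<ε → 0 , λ i _ → ℚ.≤-trans
  (/-mono 0 0 (isqrt (m ℕ.* (suc i ℕ.* suc i))) i z≤n)
  (subst (ℚ._≤ √-seq m i ℚ.+ ε) (ℚ.+-identityʳ (√-seq m i))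
    (ℚ.+-monoʳ-≤ (√-seq m i) (ℚ.<⇒≤ 0<ε)))

√-sq : ∀ m → √ m * √ m ≈ fromℕ m
√-sq m = mk≈ λ ε 0<ε →
  let N , h = archimedean ε 0<ε
  in c ℕ.* suc N , λ i N≤i → ∣p-q∣≤ (lower i 0<ε) (upper i N h N≤i)
  where
  open +-*-Solver
  c = suc m ℕ.+ suc m
  r : ℕ → ℕ
  r i = isqrt (m ℕ.* (suc i ℕ.* suc i))

  sq≡ : ∀ i → √-seq m i ℚ.* √-seq m i ≡ + (r i ℕ.* r i) ℚ./ (suc i ℕ.* suc i)
  sq≡ i = /-* (r i) i (r i) i

  lower : ∀ i {ε} → 0ℚ ℚ.< ε → √-seq m i ℚ.* √-seq m i ℚ.≤ + m ℚ./ 1 ℚ.+ ε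
  lower i {ε} 0<ε = begin
    √-seq m i ℚ.* √-seq m i                 ≡⟨ sq≡ i ⟩
    + (r i ℕ.* r i) ℚ./ (suc i ℕ.* suc i)
      ≤⟨ /-mono (r i ℕ.* r i) (i ℕ.+ i ℕ.* suc i) m 0
           (subst (ℕ._≤ m ℕ.* (suc i ℕ.* suc i)) (sym (ℕ.*-identityʳ (r i ℕ.* r i)))
             (isqrt-lower (m ℕ.* (suc i ℕ.* suc i)))) ⟩
    + m ℚ./ 1                               ≡⟨ sym (ℚ.+-identityʳ (+ m ℚ./ 1)) ⟩
    + m ℚ./ 1 ℚ.+ 0ℚ                        ≤⟨ ℚ.+-monoʳ-≤ (+ m ℚ./ 1) (ℚ.<⇒≤ 0<ε) ⟩
    + m ℚ./ 1 ℚ.+ ε                         ∎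
    where open ℚ.≤-Reasoning

  r-bound : ∀ i → r i ℕ.< suc m ℕ.* suc i
  r-bound i = sq-cancel-< (ℕ.≤-<-trans (isqrt-lower (m ℕ.* (suc i ℕ.* suc i)))
    (subst (m ℕ.* (suc i ℕ.* suc i) ℕ.<_)
      (solve 2 (λ a k → (a :* a) :* (k :* k) := (a :* k) :* (a :* k)) refl (suc m) (suc i))
      (ℕ.*-monoˡ-< (suc i ℕ.* suc i) (ℕ.m≤m*n (suc m) (suc m)))))

  upper : ∀ i N {ε} → + 1 ℚ./ suc N ℚ.≤ ε → c ℕ.* suc N ℕ.≤ i →
          + m ℚ./ 1 ℚ.≤ √-seq m i ℚ.* √-seq m i ℚ.+ ε
  upper i N {ε} h N≤i = begin
    + m ℚ./ 1
      ≤⟨ /-mono m 0 (r i ℕ.* r i ℕ.+ e) kk-1 mkk≤ ⟩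
    + (r i ℕ.* r i ℕ.+ e) ℚ./ (k ℕ.* k)
      ≡⟨ sym (/-+ (r i ℕ.* r i) e kk-1) ⟩
    + (r i ℕ.* r i) ℚ./ (k ℕ.* k) ℚ.+ + e ℚ./ (k ℕ.* k)
      ≤⟨ ℚ.+-mono-≤ (ℚ.≤-reflexive (sym (sq≡ i)))
           (ℚ.≤-trans (/-mono e kk-1 1 N e≤) h) ⟩
    √-seq m i ℚ.* √-seq m i ℚ.+ ε ∎
    where
    open ℚ.≤-Reasoning
    k = suc i
    kk-1 = i ℕ.+ i ℕ.* suc i
    e = suc (r i) ℕ.+ r i
    mkk≤ : m ℕ.* (k ℕ.* k) ℕ.≤ (r i ℕ.* r i ℕ.+ e) ℕ.* 1
    mkk≤ = subst (m ℕ.* (k ℕ.* k) ℕ.≤_)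
      (solve 1 (λ r → (con 1 :+ r) :* (con 1 :+ r)
                    := (r :* r :+ ((con 1 :+ r) :+ r)) :* con 1) refl (r i))
      (ℕ.<⇒≤ (isqrt-upper (m ℕ.* (k ℕ.* k))))
    e≤ : e ℕ.* suc N ℕ.≤ 1 ℕ.* (k ℕ.* k)
    e≤ = ℕ.≤-trans
      (ℕ.*-monoˡ-≤ (suc N) (ℕ.+-mono-≤ (r-bound i) (ℕ.<⇒≤ (r-bound i))))
      (subst₂ ℕ._≤_
        (solve 3 (λ a n k → ((a :+ a) :* n) :* k := (a :* k :+ a :* k) :* n) refl (suc m) (suc N) k)
        (sym (ℕ.*-identityˡ (k ℕ.* k)))
        (ℕ.*-monoˡ-≤ k (ℕ.≤-trans N≤i (ℕ.n≤1+n i))))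

√-pos : ∀ m → Positive (√ suc m)
√-pos m = mkPos 1ℚ (ℚ.positive⁻¹ 1ℚ) 0 λ i _ →
  let k = suc i ; r = isqrt (suc m ℕ.* (k ℕ.* k)) in
  /-mono 1 0 r i
    (subst₂ ℕ._≤_ (sym (ℕ.*-identityˡ k)) (sym (ℕ.*-identityʳ r))
      (ℕ.≤-pred (sq-cancel-< {k} {suc r} (ℕ.≤-<-trans (ℕ.m≤m+n (k ℕ.* k) (m ℕ.* (k ℕ.* k)))
        (isqrt-upper (suc m ℕ.* (k ℕ.* k)))))))

-- Only evaluated at positive arguments in the Randić index, since the
-- endpoints of an edge have positive degree; the value at 0 is a convention.
1/√_ : ℕ → ℝ
1/√ zero  = 0ℝ
1/√ suc m = inverse (√ suc m) (√-pos m)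

record Graph (n : ℕ) : Set₁ where
  field
    Adj    : Rel (Fin n) 0ℓ
    adj?   : Decidable Adj
    symm   : Symmetric Adj
    irrefl : Irreflexive _≡_ Adj

module _ {n : ℕ} (G : Graph n) where
  open Graph G using (Adj; adj?)

  degree : Fin n → ℕ
  degree v = length (filter (adj? v) (allFin n))

  -- Each unordered edge is listed once, with its smaller endpoint first.
  edges : List (Fin n × Fin n)
  edges = filter (λ (u , v) → (u Fin.<? v) ×-dec adj? u v)
                 (cartesianProduct (allFin n) (allFin n))

  randić : ℝ
  randić = sumℝ (map (λ (u , v) → 1/√ (degree u ℕ.* degree v)) edges)

  Connected : Set
  Connected = ∀ u v → Star Adj u v

  -- The cycle v, v₁, …, vₖ, v, where vs = v₁ … vₖ.
  IsCycle : Fin n → List (Fin n) → Set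
  IsCycle v vs = 2 ℕ.≤ length vs × Unique (v ∷ vs) × Linked Adj (v ∷ vs ∷ʳ v)

  Acyclic : Set
  Acyclic = ∀ v vs → ¬ IsCycle v vs

  record IsTree : Set where
    field
      nonEmpty  : 0 ℕ.< n
      connected : Connected
      acyclic   : Acyclic

  IsStar : Set
  IsStar = IsTree × ∃ λ c → ∀ v → v ≢ c → Adj c v

{-# OPTIONS --safe #-}

-- Since √ d_v = d_v / √ d_v, the sum of √ d_v over the vertices is the sum of
-- 1/√ d_u + 1/√ d_v over the edges uv. A tree has n − 1 edges, so R(G) minus the
-- right-hand side is the sum of (1 − 1/√ d_u)(1 − 1/√ d_v) ≥ 0 over the edges,
-- and in a star every edge has an endpoint of degree 1.

module Submission where

open import Defs
open import Algebra.Bundles using (CommutativeMonoid)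
open import Algebra.Core using (Op₂)
import Algebra.Properties.CommutativeSemigroup as CommutativeSemigroupProperties
import Algebra.Properties.Monoid.Mult as Mult
open import Algebra.Structures using (IsCommutativeMonoid)
open import Data.Bool.Base using (if_then_else_)
open import Data.Fin.Base as Fin using (Fin; zero; suc; punchIn; punchOut)
import Data.Fin.Properties as Fin
open import Data.Integer.Base using (+_)
open import Data.List.Base
  using (List; []; _∷_; _∷ʳ_; _++_; length; map; foldr; filter; allFin; cartesianProduct)
import Data.List.Membership.DecPropositional as DecMembership
open import Data.List.Membership.Propositional using (_∈_)
open import Data.List.Membership.Propositional.Properties
  using (∈-allFin; ∈-cartesianProduct⁺; ∈-filter⁺; ∈-filter⁻)
open import Data.List.Properties using (length-tabulate)
open import Data.List.Relation.Unary.All as All using (All; []; _∷_)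
open import Data.List.Relation.Unary.All.Properties using (¬Any⇒All¬)
open import Data.List.Relation.Unary.AllPairs using ([]; _∷_)
open import Data.List.Relation.Unary.Any using (here; there)
open import Data.List.Relation.Unary.Linked using (Linked; [-]; _∷_)
open import Data.List.Relation.Unary.Unique.Propositional using (Unique)
import Data.List.Relation.Unary.Unique.Propositional.Properties as Unique
open import Data.Nat.Base as ℕ using (ℕ; zero; suc; z≤n; s≤s)
import Data.Nat.Properties as ℕ
open import Data.Nat.Solver using (module +-*-Solver)
open import Data.Product.Base using (∃; _×_; _,_; proj₁; proj₂)
open import Data.Rational.Base as ℚ using (ℚ; 0ℚ; 1ℚ; ½; ∣_∣)
import Data.Rational.Properties as ℚ
import Data.Rational.Solver as ℚ
open import Data.Sum.Base as Sum using (_⊎_; inj₁; inj₂; [_,_]′)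
open import Function.Base using (_∘_; const; id)
open import Level using (Level; 0ℓ)
open import Relation.Binary.Bundles using (Poset)
open import Relation.Binary.Construct.Closure.ReflexiveTransitive as Star
  using (Star; _◅_; _◅◅_)
open import Relation.Binary.Core using (Rel; _⇒_)
open import Relation.Binary.Definitions using (DecidableEquality; tri<; tri≈; tri>)
open import Relation.Binary.PropositionalEquality
  using (_≡_; _≢_; refl; sym; trans; cong; cong₂; subst; subst₂; module ≡-Reasoning)
import Relation.Binary.Reasoning.Setoid as SetoidReasoning
open import Relation.Binary.Structures using (IsPartialOrder)
open import Relation.Nullary using (Dec; does; ¬_; yes; no; contradiction)
open import Relation.Nullary.Decidable using (_×-dec_)
open import Relation.Unary using (Pred; Decidable)

private variable
  a ℓ′ : Level
  A B : Set a
  n : ℕ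

-- Trees

-- The list holds the vertices after the start, so `u ∷ ws` is the full vertex list, in the form
-- that `Unique` and `IsCycle` expect.
data Walk {A : Set a} (R : Rel A a) (z : A) : A → List A → Set a where
  []  : Walk R z z []
  _∷_ : ∀ {u w ws} → R u w → Walk R z w ws → Walk R z u (w ∷ ws)

module _ {A : Set a} {R : Rel A a} where

  from-vertex : ∀ {u w z ws} → Walk R z w ws → Unique (w ∷ ws) → u ∈ w ∷ ws →
                ∃ λ vs → Walk R z u vs × Unique (u ∷ vs)
  from-vertex π       uq       (here refl) = _ , π , uq
  from-vertex (_ ∷ π) (_ ∷ uq) (there u∈)  = from-vertex π uq u∈

  -- Induction along the path: if `u` already lies on the simple walk from its successor, the part
  -- of that walk before `u` is cut off; otherwise `u` is prepended.
  loop-erase : DecidableEquality A → ∀ {u z} → Star R u z →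
               ∃ λ vs → Walk R z u vs × Unique (u ∷ vs)
  loop-erase _≟_ Star.ε = [] , [] , [] ∷ []
  loop-erase _≟_ {u} (_◅_ {j = w} r p)
    with ws , π , uq ← loop-erase _≟_ p
    with DecMembership._∈?_ _≟_ u (w ∷ ws)
  ... | yes u∈ = from-vertex π uq u∈
  ... | no  u∉ = w ∷ ws , r ∷ π , ¬Any⇒All¬ _ u∉ ∷ uq

  -- The walk may live in a smaller relation `R` than the closing step. With `x` equal to `u` this
  -- yields the `Linked` component of `IsCycle`.
  close : ∀ {S : Rel A a} {u x z ws} → R ⇒ S → Walk R z u ws → S z x →
          Linked S (u ∷ ws ∷ʳ x)
  close f []      s = s ∷ [-]
  close f (r ∷ π) s = f r ∷ close f π s

-- Forests and the number of their components

Joined : List (A × A) → Rel A _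
Joined es u v = (u , v) ∈ es ⊎ (v , u) ∈ es

weaken : ∀ {es : List (A × A)} {e} → Joined es ⇒ Joined (e ∷ es)
weaken = Sum.map there there

-- Acyclicity in incremental form: read from the back of the list, every edge joins two vertices
-- that the edges after it leave in different components.
data Forest {A : Set a} : List (A × A) → Set a where
  []  : Forest []
  _∷_ : ∀ {u v es} → ¬ Star (Joined es) u v → Forest es → Forest ((u , v) ∷ es)

-- `rep` is a section of `label`, so every label is taken and `count` is the exact number of
-- components. The field `size` is the invariant from which the edge count of a tree is read off.
record Components (n : ℕ) (es : List (Fin n × Fin n)) : Set where
  field
    count     : ℕ
    label     : Fin n → Fin count
    rep       : Fin count → Fin n
    label-rep : ∀ i → label (rep i) ≡ i
    sound     : ∀ {u v} → label u ≡ label v → Star (Joined es) u v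
    complete  : ∀ {u v} → Joined es u v → label u ≡ label v
    size      : length es ℕ.+ count ≡ n

discrete : Components n []
discrete = record
  { label = id ; rep = id ; label-rep = λ _ → refl
  ; sound = λ { refl → Star.ε } ; complete = λ { (inj₁ ()) ; (inj₂ ()) } ; size = refl }

-- The label of u is redirected to that of v and deleted, so each edge of a forest
-- lowers the number of components by exactly one.
merge : ∀ {u v es} → ¬ Star (Joined es) u v →
        Components n es → Components n ((u , v) ∷ es)
merge {n} {u} {v} {es} u≁v C with Components.count C | Components.label C
  | Components.rep C | Components.label-rep C | Components.sound C
  | Components.complete C | Components.size C
... | zero  | label | _ | _ | _ | _ | _ = contradiction (label u) Fin.¬Fin0
... | suc k | label | rep | label-rep | sound | complete | size = record
  { count = k ; label = λ w → punchOut (redirect≢ w) ; rep = rep ∘ punchIn (label u)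
  ; label-rep = label′-rep
  ; sound = λ {x} {y} → sound′ x y ∘ Fin.punchOut-injective (redirect≢ x) (redirect≢ y)
  ; complete = λ {x} {y} → Fin.punchOut-cong (label u) ∘ complete′ x y
  ; size = trans (sym (ℕ.+-suc (length es) k)) size }
  where
  u≢v : label u ≢ label v
  u≢v = u≁v ∘ sound

  redirect : Fin n → Fin (suc k)
  redirect w with label u Fin.≟ label w
  ... | yes _ = label v
  ... | no  _ = label w

  redirect≢ : ∀ w → label u ≢ redirect w
  redirect≢ w with label u Fin.≟ label w
  ... | yes _ = u≢v
  ... | no ≢w = ≢w

  redirect-cong : ∀ {x y} → label x ≡ label y → redirect x ≡ redirect y
  redirect-cong {x} {y} eq with label u Fin.≟ label x | label u Fin.≟ label y
  ... | yes _ | yes _ = refl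
  ... | no  _ | no  _ = eq
  ... | yes p | no ¬q = contradiction (trans p eq) ¬q
  ... | no ¬p | yes q = contradiction (trans q (sym eq)) ¬p

  redirect-id : ∀ {w} → label u ≢ label w → redirect w ≡ label w
  redirect-id {w} ≢w with label u Fin.≟ label w
  ... | yes p = contradiction p ≢w
  ... | no  _ = refl

  redirect-u : redirect u ≡ label v
  redirect-u with label u Fin.≟ label u
  ... | yes _ = refl
  ... | no ¬p = contradiction refl ¬p

  -- The old label `punchIn (label u) i` of the representative differs from `label u`, so it is not
  -- redirected, and `punchOut` undoes `punchIn`.
  label′-rep : ∀ i → punchOut (redirect≢ (rep (punchIn (label u) i))) ≡ i
  label′-rep i = trans (Fin.punchOut-cong (label u)
      (trans (redirect-id λ p → i≢ (trans p (label-rep _))) (label-rep _)))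
    (Fin.punchOut-punchIn (label u))
    where
    i≢ : label u ≢ punchIn (label u) i
    i≢ = Fin.punchInᵢ≢i (label u) i ∘ sym

  old : ∀ {x y} → label x ≡ label y → Star (Joined ((u , v) ∷ es)) x y
  old = Star.map weaken ∘ sound

  sound′ : ∀ x y → redirect x ≡ redirect y → Star (Joined ((u , v) ∷ es)) x y
  sound′ x y eq with label u Fin.≟ label x | label u Fin.≟ label y
  ... | yes p | yes q = old (trans (sym p) q)
  -- Here `x` lies in the old component of `u` and `y` in that of `v`: the path runs from `x` to
  -- `u`, over the new edge, and from `v` to `y`.
  ... | yes p | no  _ = old (sym p) ◅◅ inj₁ (here refl) ◅ old eq
  ... | no  _ | yes q = old eq ◅◅ inj₂ (here refl) ◅ old q
  ... | no  _ | no  _ = old eq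

  redirect-uv : redirect u ≡ redirect v
  redirect-uv = trans redirect-u (sym (redirect-id u≢v))

  complete′ : ∀ x y → Joined ((u , v) ∷ es) x y → redirect x ≡ redirect y
  complete′ x y (inj₁ (here refl)) = redirect-uv
  complete′ x y (inj₂ (here refl)) = sym redirect-uv
  complete′ x y (inj₁ (there e))   = redirect-cong (complete (inj₁ e))
  complete′ x y (inj₂ (there e))   = redirect-cong (complete (inj₂ e))

components : ∀ {es} → Forest es → Components n es
components []        = discrete
components (u≁v ∷ f) = merge u≁v (components f)

-- `label` is constant along paths, so every label `i`, being the label of `rep i`, equals the label
-- of vertex `zero`, which exists because `n` is positive.
connected⇒one : ∀ {es} (C : Components n es) → 0 ℕ.< n →
                (∀ u v → Star (Joined es) u v) → Components.count C ≡ 1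
connected⇒one {suc n} C _ conn = ones (label zero) λ i →
    trans (sym (label-rep i)) (same (conn (rep i) zero))
  where
  open Components C
  same : ∀ {u v} → Star (Joined _) u v → label u ≡ label v
  same = Star.fold (λ u v → label u ≡ label v) (trans ∘ complete) refl

  ones : ∀ {k} (j : Fin k) → (∀ i → i ≡ j) → k ≡ 1
  ones {suc zero}    _ _  = refl
  ones {suc (suc k)} j eq = contradiction (trans (eq zero) (sym (eq (suc zero)))) λ ()

-- The edge count of a tree and the leaves of a star

all-equal⇒length≡1 : ∀ {x : A} {xs} → Unique xs → x ∈ xs → (∀ {y} → y ∈ xs → y ≡ x) →
                     length xs ≡ 1
all-equal⇒length≡1 {xs = _ ∷ []}     _              _ _  = refl
all-equal⇒length≡1 {xs = y ∷ z ∷ xs} ((y≢z ∷ _) ∷ _) _ eq =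
  contradiction (trans (eq (here refl)) (sym (eq (there (here refl))))) y≢z

module _ {n} (G : Graph n) where
  open Graph G

  ∈-edges⁻ : ∀ {u v} → (u , v) ∈ edges G → u Fin.< v × Adj u v
  ∈-edges⁻ = proj₂ ∘ ∈-filter⁻ edge? {xs = cartesianProduct (allFin n) (allFin n)}
    where edge? = λ (u , v) → (u Fin.<? v) ×-dec adj? u v

  ∈-edges⁺ : ∀ {u v} → Adj u v → Joined (edges G) u v
  ∈-edges⁺ {u} {v} uv with Fin.<-cmp u v
  ... | tri< u<v _ _  = inj₁ (∈-filter⁺ _ (∈-cartesianProduct⁺ (∈-allFin u) (∈-allFin v)) (u<v , uv))
  ... | tri≈ _ u≡v _  = contradiction uv (irrefl u≡v)
  ... | tri> _ _ v<u  = inj₂ (∈-filter⁺ _ (∈-cartesianProduct⁺ (∈-allFin v) (∈-allFin u)) (v<u , symm uv))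

  edges-unique : Unique (edges G)
  edges-unique = Unique.filter⁺ _ (Unique.cartesianProduct⁺ (Unique.allFin⁺ n) (Unique.allFin⁺ n))

  -- A path in `R` from `u` to `v` shortens to a simple walk. Length zero would make `uv` a loop and
  -- length one would put `uv` in `R`; any longer walk is closed to a cycle by the edge `vu`.
  acyclic⇒bridge : Acyclic G → ∀ {R : Rel (Fin n) 0ℓ} → R ⇒ Adj →
                   ∀ {u v} → Adj u v → ¬ R u v → ¬ Star R u v
  acyclic⇒bridge acyclic R⇒Adj uv ¬r p with loop-erase Fin._≟_ p
  ... | _ , [] , _                = irrefl refl uv
  ... | _ , r ∷ [] , _            = ¬r r
  ... | _ , π@(_ ∷ _ ∷ _) , uq    =
    acyclic _ _ (s≤s (s≤s z≤n) , uq , close R⇒Adj π (symm uv))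

  acyclic⇒forest : Acyclic G → Forest (edges G)
  acyclic⇒forest acyclic = go edges-unique (All.tabulate ∈-edges⁻)
    where
    go : ∀ {es} → Unique es → All (λ (u , v) → u Fin.< v × Adj u v) es → Forest es
    go []         []                 = []
    go {(u , v) ∷ es} (e∉ ∷ uq) ((u<v , uv) ∷ es⊆) =
      acyclic⇒bridge acyclic adj uv new ∷ go uq es⊆
      where
      adj : Joined es ⇒ Adj
      adj (inj₁ e) = proj₂ (All.lookup es⊆ e)
      adj (inj₂ e) = symm (proj₂ (All.lookup es⊆ e))
      new : ¬ Joined es u v
      new (inj₁ e) = All.lookup e∉ e refl
      -- Uniqueness excludes only a second copy of `(u , v)`; the reversed pair is excluded by the
      -- orientation from smaller to larger endpoint.
      new (inj₂ e) = ℕ.<-asym u<v (proj₁ (All.lookup es⊆ e))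

  -- The component count of the forest of all edges satisfies `length (edges G) + count ≡ n`, and
  -- connectedness makes `count` equal to 1.
  tree-size : IsTree G → suc (length (edges G)) ≡ n
  tree-size tree = trans (ℕ.+-comm 1 _) (trans
      (cong (length (edges G) ℕ.+_) (sym (connected⇒one C nonEmpty
        λ u v → Star.map ∈-edges⁺ (connected u v))))
      (Components.size C))
    where
    open IsTree tree
    C = components (acyclic⇒forest acyclic)

  -- A neighbour `w` of `v` other than the centre would be adjacent to the centre as well, giving
  -- the triangle `c`, `v`, `w`.
  star-leaf : Acyclic G → ∀ {c} → (∀ v → v ≢ c → Adj c v) → ∀ {v} → v ≢ c → degree G v ≡ 1
  star-leaf acyclic {c} centre {v} v≢c =
    all-equal⇒length≡1 (Unique.filter⁺ (adj? v) (Unique.allFin⁺ n))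
      (∈-filter⁺ (adj? v) (∈-allFin c) vc) (only ∘ proj₂ ∘ ∈-filter⁻ (adj? v) {xs = allFin n})
    where
    vc = symm (centre v v≢c)
    only : ∀ {w} → Adj v w → w ≡ c
    only {w} vw with w Fin.≟ c
    ... | yes eq  = eq
    ... | no w≢c = contradiction
      (s≤s (s≤s z≤n)
      , ((v≢c ∘ sym) ∷ (w≢c ∘ sym) ∷ []) ∷ ((λ v≡w → irrefl v≡w vw) ∷ []) ∷ [] ∷ []
      , centre v v≢c ∷ vw ∷ symm (centre w w≢c) ∷ [-])
      (acyclic c (v ∷ w ∷ []))

  -- The endpoints satisfy `u < v`, so at most one of them is the centre, and the other is a leaf.
  star-edge : IsStar G → ∀ {u v} → (u , v) ∈ edges G → degree G u ≡ 1 ⊎ degree G v ≡ 1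
  star-edge (tree , c , centre) {u} {v} e with v Fin.≟ c
  ... | no v≢c   = inj₂ (star-leaf (IsTree.acyclic tree) centre v≢c)
  ... | yes refl = inj₁ (star-leaf (IsTree.acyclic tree) centre λ u≡c → Fin.<⇒≢ (proj₁ (∈-edges⁻ e)) u≡c)

-- Sums over lists and over the edges of a graph

module Summation {c ℓ} {C : Set c} {_≋_ : Rel C ℓ} {_∙_ : Op₂ C} {ε : C}
                 (isCommutativeMonoid : IsCommutativeMonoid _≋_ _∙_ ε) where
  private
    M : CommutativeMonoid c ℓ
    M = record { isCommutativeMonoid = isCommutativeMonoid }

  open CommutativeMonoid M
    using (setoid; monoid; commutativeSemigroup; comm; assoc; identityˡ; identityʳ;
           ∙-cong; ∙-congˡ; ∙-congʳ)
    renaming (refl to ≋-refl; sym to ≋-sym; trans to ≋-trans)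
  open CommutativeSemigroupProperties commutativeSemigroup using (interchange)
  open Mult monoid using (×-congˡ)
  open Mult monoid using () renaming (_×_ to _·_) public
  open SetoidReasoning setoid

  ∑ : List A → (A → C) → C
  ∑ xs f = foldr _∙_ ε (map f xs)

  -- An indicator: it turns a sum over a filtered list into a sum over the whole list, where the
  -- order of a double sum can be exchanged.
  when : Dec A → C → C
  when d x = if does d then x else ε

  ∑-cong : ∀ (xs : List A) {f g} → (∀ x → f x ≋ g x) → ∑ xs f ≋ ∑ xs g
  ∑-cong []       f≋g = ≋-refl
  ∑-cong (x ∷ xs) f≋g = ∙-cong (f≋g x) (∑-cong xs f≋g)

  ∑-∙ : ∀ (xs : List A) (f g : A → C) → ∑ xs (λ x → f x ∙ g x) ≋ (∑ xs f ∙ ∑ xs g)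
  ∑-∙ []       f g = ≋-sym (identityˡ ε)
  ∑-∙ (x ∷ xs) f g = ≋-trans (∙-congˡ (∑-∙ xs f g)) (interchange _ _ _ _)

  ∑-const : ∀ (xs : List A) x → ∑ xs (const x) ≋ (length xs · x)
  ∑-const []       x = ≋-refl
  ∑-const (_ ∷ xs) x = ∙-congˡ (∑-const xs x)

  ∑-ε : ∀ (xs : List A) → ∑ xs (const ε) ≋ ε
  ∑-ε []       = ≋-refl
  ∑-ε (_ ∷ xs) = ≋-trans (identityˡ _) (∑-ε xs)

  ∑-swap : ∀ (xs : List A) (ys : List B) (f : A → B → C) →
           ∑ xs (λ x → ∑ ys (f x)) ≋ ∑ ys (λ y → ∑ xs (λ x → f x y))
  ∑-swap []       ys f = ≋-sym (∑-ε ys)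
  ∑-swap (x ∷ xs) ys f = ≋-trans (∙-congˡ (∑-swap xs ys f)) (≋-sym (∑-∙ ys (f x) _))

  ∑-filter : ∀ {P : Pred A ℓ′} (P? : Decidable P) xs (f : A → C) →
             ∑ (filter P? xs) f ≋ ∑ xs (λ x → when (P? x) (f x))
  ∑-filter P? []       f = ≋-refl
  ∑-filter P? (x ∷ xs) f with P? x
  ... | yes _ = ∙-congˡ (∑-filter P? xs f)
  ... | no  _ = ≋-trans (∑-filter P? xs f) (≋-sym (identityˡ _))

  ∑-cartesianProduct : ∀ (xs : List A) (ys : List B) f →
    ∑ (cartesianProduct xs ys) f ≋ ∑ xs (λ x → ∑ ys (λ y → f (x , y)))
  ∑-cartesianProduct []       ys f = ≋-refl
  ∑-cartesianProduct (x ∷ xs) ys f = go ys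
    where
    go : ∀ zs → ∑ (map (x ,_) zs ++ cartesianProduct xs ys) f ≋
                (∑ zs (λ y → f (x , y)) ∙ ∑ xs (λ x → ∑ ys (λ y → f (x , y))))
    go []       = ≋-trans (∑-cartesianProduct xs ys f) (≋-sym (identityˡ _))
    go (z ∷ zs) = ≋-trans (∙-congˡ (go zs)) (≋-sym (assoc _ _ _))

  ∑-const-∙ : ∀ (xs : List A) x f → ∑ xs (λ a → x ∙ f a) ≋ (∑ xs f ∙ (length xs · x))
  ∑-const-∙ xs x f = ≋-trans (∑-∙ xs (const x) f) (≋-trans (∙-congʳ (∑-const xs x)) (comm _ _))

  when-∙ : ∀ (d : Dec A) x y → when d (x ∙ y) ≋ (when d x ∙ when d y)
  when-∙ (yes _) x y = ≋-refl
  when-∙ (no  _) x y = ≋-sym (identityˡ ε)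

  when-⊎ : ∀ {P Q R : Set ℓ′} x (d : Dec P) (e : Dec Q) (r : Dec R) →
           (P → R) → (Q → R) → (R → P ⊎ Q) → (P → ¬ Q) →
           (when d x ∙ when e x) ≋ when r x
  when-⊎ x (yes p) (yes q) _       _   _   _   ex = contradiction q (ex p)
  when-⊎ x (yes p) (no  _) (yes _) _   _   _   _  = identityʳ x
  when-⊎ x (no  _) (yes q) (yes _) _   _   _   _  = identityˡ x
  when-⊎ x (no  _) (no  _) (no  _) _   _   _   _  = identityˡ ε
  when-⊎ x (yes p) (no  _) (no ¬r) p→r _   _   _  = contradiction (p→r p) ¬r
  when-⊎ x (no  _) (yes q) (no ¬r) _   q→r _   _  = contradiction (q→r q) ¬r
  when-⊎ x (no ¬p) (no ¬q) (yes r) _   _   r→⊎ _  = contradiction (r→⊎ r) [ ¬p , ¬q ]′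

  -- Double counting over the edges of a graph

  module _ {n} (G : Graph n) where
    open Graph G

    private
      V = allFin n
      oriented? = λ u v → (u Fin.<? v) ×-dec adj? u v

    -- Adjacent vertices are distinct, so exactly one of the two orderings puts the smaller endpoint
    -- first.
    when-oriented : ∀ u v x →
      (when (oriented? u v) x ∙ when (oriented? v u) x) ≋ when (adj? u v) x
    when-oriented u v x = when-⊎ x (oriented? u v) (oriented? v u) (adj? u v)
      proj₂ (symm ∘ proj₂) orient λ (u<v , _) (v<u , _) → ℕ.<-asym u<v v<u
      where
      orient : Adj u v → (u Fin.< v × Adj u v) ⊎ (v Fin.< u × Adj v u)
      orient uv with Fin.<-cmp u v
      ... | tri< u<v _ _ = inj₁ (u<v , uv)
      ... | tri≈ _ u≡v _ = contradiction uv (irrefl u≡v)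
      ... | tri> _ _ v<u = inj₂ (v<u , symm uv)

    -- Each vertex contributes its value once per incident edge. The edge sum is spread over all
    -- ordered pairs of vertices and regrouped by vertex.
    handshake : ∀ (x : Fin n → C) →
      ∑ (edges G) (λ (u , v) → x u ∙ x v) ≋ ∑ V (λ v → degree G v · x v)
    handshake x = begin
      ∑ (edges G) (λ (u , v) → x u ∙ x v)
        ≈⟨ ∑-filter _ (cartesianProduct V V) _ ⟩
      ∑ (cartesianProduct V V) (λ (u , v) → when (oriented? u v) (x u ∙ x v))
        ≈⟨ ∑-cartesianProduct V V _ ⟩
      ∑ V (λ u → ∑ V λ v → when (oriented? u v) (x u ∙ x v))
        ≈⟨ ∑-cong V (λ u → ∑-cong V λ v → when-∙ (oriented? u v) (x u) (x v)) ⟩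
      ∑ V (λ u → ∑ V λ v → when (oriented? u v) (x u) ∙ when (oriented? u v) (x v))
        ≈⟨ ∑-cong V (λ u → ∑-∙ V _ _) ⟩
      ∑ V (λ u → ∑ V (λ v → when (oriented? u v) (x u)) ∙
                 ∑ V (λ v → when (oriented? u v) (x v)))
        ≈⟨ ∑-∙ V _ _ ⟩
      ∑ V (λ u → ∑ V λ v → when (oriented? u v) (x u)) ∙
      ∑ V (λ u → ∑ V λ v → when (oriented? u v) (x v))
        -- Exchanging the sums and renaming gives both halves the weight `x u`, with opposite
        -- orientations that then combine into adjacency.
        ≈⟨ ∙-congˡ (∑-swap V V _) ⟩
      ∑ V (λ u → ∑ V λ v → when (oriented? u v) (x u)) ∙
      ∑ V (λ u → ∑ V λ v → when (oriented? v u) (x u))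
        ≈⟨ ∑-∙ V _ _ ⟨
      ∑ V (λ u → ∑ V (λ v → when (oriented? u v) (x u)) ∙
                 ∑ V (λ v → when (oriented? v u) (x u)))
        ≈⟨ ∑-cong V (λ u → ∑-∙ V _ _) ⟨
      ∑ V (λ u → ∑ V λ v → when (oriented? u v) (x u) ∙ when (oriented? v u) (x u))
        ≈⟨ ∑-cong V (λ u → ∑-cong V λ v → when-oriented u v (x u)) ⟩
      ∑ V (λ u → ∑ V λ v → when (adj? u v) (x u))
        ≈⟨ ∑-cong V (λ u → ∑-filter (adj? u) V _) ⟨
      ∑ V (λ u → ∑ (filter (adj? u) V) (const (x u)))
        ≈⟨ ∑-cong V (λ u → ∑-const (filter (adj? u) V) (x u)) ⟩
      ∑ V (λ v → degree G v · x v) ∎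

    -- A monoid has no subtraction, so `one` is added once per edge instead. Together with the
    -- leading `one` this makes one copy per vertex, which turns `y v` into `degree G v · x v`.
    tree-handshake : IsTree G → ∀ one (x y : Fin n → C) →
      (∀ v → (degree G v · x v) ≋ (y v ∙ one)) →
      ((one ∙ ∑ V y) ∙ (length (edges G) · one)) ≋ ∑ (edges G) (λ (u , v) → x u ∙ x v)
    tree-handshake tree one x y dx≋y+1 = begin
      (one ∙ ∑ V y) ∙ (length (edges G) · one) ≈⟨ ∙-congʳ (comm one (∑ V y)) ⟩
      (∑ V y ∙ one) ∙ (length (edges G) · one) ≈⟨ assoc (∑ V y) one _ ⟩
      ∑ V y ∙ (suc (length (edges G)) · one)
        -- The tree enters here: one more than the number of edges is the number of vertices.
        ≈⟨ ∙-congˡ (×-congˡ (trans (tree-size G tree) (sym (length-tabulate id)))) ⟩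
      ∑ V y ∙ (length V · one)               ≈⟨ ∙-congˡ (∑-const V one) ⟨
      ∑ V y ∙ ∑ V (const one)                ≈⟨ ∑-∙ V y (const one) ⟨
      ∑ V (λ v → y v ∙ one)                  ≈⟨ ∑-cong V dx≋y+1 ⟨
      ∑ V (λ v → degree G v · x v)           ≈⟨ handshake x ⟨
      ∑ (edges G) (λ (u , v) → x u ∙ x v)    ∎

  -- The two sums are given up to ≡ so that an instance in ℝ can state its
  -- conclusion literally: converting sums in ℝ unfolds the Cauchy moduli.
  module TreeSum {r} {_≲_ : Rel C r} (isPartialOrder : IsPartialOrder _≋_ _≲_)
    (∙-mono : ∀ {w x y z} → w ≲ x → y ≲ z → (w ∙ y) ≲ (x ∙ z))
    (∙-cancelʳ : ∀ {x y} z → (x ∙ z) ≲ (y ∙ z) → x ≲ y)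
    {n} (G : Graph n) (tree : IsTree G)
    (one : C) (x y : Fin n → C) (w : Fin n × Fin n → C)
    (s r : C) (s≡ : s ≡ ∑ (allFin n) y) (r≡ : r ≡ ∑ (edges G) w)
    (dx≋y+1 : ∀ v → (degree G v · x v) ≋ (y v ∙ one))
    where

    open IsPartialOrder isPartialOrder using ()
      renaming (refl to ≲-refl; trans to ≲-trans; reflexive to ≲-reflexive)

    ∑-mono : ∀ (xs : List A) {f g} → (∀ {x} → x ∈ xs → f x ≲ g x) → ∑ xs f ≲ ∑ xs g
    ∑-mono []       f≲g = ≲-refl
    ∑-mono (x ∷ xs) f≲g = ∙-mono (f≲g (here refl)) (∑-mono xs (f≲g ∘ there))

    private
      vertex-∑≋ = tree-handshake G tree one x y dx≋y+1
      edge-∑≋ = ∑-const-∙ (edges G) one w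

    -- After `one` is added once per edge, both sides are sums over the edges and are compared term
    -- by term; the added copies are then cancelled.
    vertex-∑≲edge-∑ : (∀ u v → (u , v) ∈ edges G → (x u ∙ x v) ≲ (one ∙ w (u , v))) →
                      (one ∙ s) ≲ r
    vertex-∑≲edge-∑ le rewrite s≡ | r≡ = ∙-cancelʳ (length (edges G) · one)
      (≲-trans (≲-reflexive vertex-∑≋)
        (≲-trans (∑-mono (edges G) (le _ _)) (≲-reflexive edge-∑≋)))

    edge-∑≲vertex-∑ : (∀ u v → (u , v) ∈ edges G → (one ∙ w (u , v)) ≲ (x u ∙ x v)) →
                      r ≲ (one ∙ s)
    edge-∑≲vertex-∑ ge rewrite s≡ | r≡ = ∙-cancelʳ (length (edges G) · one)
      (≲-trans (≲-reflexive (≋-sym edge-∑≋))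
        (≲-trans (∑-mono (edges G) (ge _ _)) (≲-reflexive (≋-sym vertex-∑≋))))

-- Real numbers

open ℚ-Lemmas
open /-Lemmas

private variable
  w x y z : ℝ

p≤∣p∣ : ∀ p → p ℚ.≤ ∣ p ∣
p≤∣p∣ p with ℚ.≤-total 0ℚ p
... | inj₁ 0≤p = ℚ.≤-reflexive (sym (ℚ.0≤p⇒∣p∣≡p 0≤p))
... | inj₂ p≤0 = ℚ.≤-trans p≤0 (ℚ.0≤∣p∣ p)

p≤p+ε : ∀ {p ε} → 0ℚ ℚ.< ε → p ℚ.≤ p ℚ.+ ε
p≤p+ε {p} {ε} 0<ε = subst (ℚ._≤ p ℚ.+ ε) (ℚ.+-identityʳ p) (ℚ.+-monoʳ-≤ p (ℚ.<⇒≤ 0<ε))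

0≤q-p⇒p≤q : ∀ {p q} → 0ℚ ℚ.≤ q ℚ.- p → p ℚ.≤ q
0≤q-p⇒p≤q {p} {q} h = subst₂ ℚ._≤_ (ℚ.+-identityˡ p)
  (solve 2 (λ p q → (q :- p) :+ p := q) refl p q) (ℚ.+-monoˡ-≤ p h)
  where open ℚ.+-*-Solver

pointwise-≤ : (∀ i → seq x i ℚ.≤ seq y i) → x ≤ y
pointwise-≤ h = mk≤ λ ε 0<ε → 0 , λ i _ → ℚ.≤-trans (h i) (p≤p+ε 0<ε)

≤-antisym : x ≤ y → y ≤ x → x ≈ y
≤-antisym (mk≤ f) (mk≤ g) = mk≈ λ ε 0<ε →
  let M , p = f ε 0<ε
      N , q = g ε 0<ε
  in M ℕ.⊔ N , λ i h → ∣p-q∣≤ (p i (ℕ.m⊔n≤o⇒m≤o M N h)) (q i (ℕ.m⊔n≤o⇒n≤o M N h))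

pointwise-≈ : (∀ i → seq x i ≡ seq y i) → x ≈ y
pointwise-≈ h = ≤-antisym (pointwise-≤ (ℚ.≤-reflexive ∘ h)) (pointwise-≤ (ℚ.≤-reflexive ∘ sym ∘ h))

≈-refl : x ≈ x
≈-refl = pointwise-≈ λ _ → refl

≈-sym : x ≈ y → y ≈ x
≈-sym {x} {y} (mk≈ f) = mk≈ λ ε 0<ε → let N , p = f ε 0<ε in
  N , λ i h → subst (ℚ._≤ ε) (∣p-q∣≡∣q-p∣ (seq x i) (seq y i)) (p i h)

≈⇒≤ : x ≈ y → x ≤ y
≈⇒≤ {x} {y} (mk≈ f) = mk≤ λ ε 0<ε → let N , p = f ε 0<ε in
  N , λ i h → subst (ℚ._≤ seq y i ℚ.+ ε)
    (solve 2 (λ p q → q :+ (p :- q) := p) refl (seq x i) (seq y i))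
    (ℚ.+-monoʳ-≤ (seq y i) (ℚ.≤-trans (p≤∣p∣ _) (p i h)))
  where open ℚ.+-*-Solver

≤-trans : x ≤ y → y ≤ z → x ≤ z
≤-trans {x} {y} {z} (mk≤ f) (mk≤ g) = mk≤ λ ε 0<ε →
  let M , p = f (½ ℚ.* ε) (0<½* 0<ε)
      N , q = g (½ ℚ.* ε) (0<½* 0<ε)
  in M ℕ.⊔ N , λ i h → begin
    seq x i                             ≤⟨ p i (ℕ.m⊔n≤o⇒m≤o M N h) ⟩
    seq y i ℚ.+ ½ ℚ.* ε                 ≤⟨ ℚ.+-monoˡ-≤ (½ ℚ.* ε) (q i (ℕ.m⊔n≤o⇒n≤o M N h)) ⟩
    (seq z i ℚ.+ ½ ℚ.* ε) ℚ.+ ½ ℚ.* ε   ≡⟨ ℚ.+-assoc (seq z i) _ _ ⟩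
    seq z i ℚ.+ (½ ℚ.* ε ℚ.+ ½ ℚ.* ε)   ≡⟨ cong (seq z i ℚ.+_) (½+½ ε) ⟩
    seq z i ℚ.+ ε                       ∎
  where open ℚ.≤-Reasoning

≈-trans : x ≈ y → y ≈ z → x ≈ z
≈-trans p q = ≤-antisym (≤-trans (≈⇒≤ p) (≈⇒≤ q)) (≤-trans (≈⇒≤ (≈-sym q)) (≈⇒≤ (≈-sym p)))

≤-poset : Poset _ _ _
≤-poset = record
  { Carrier = ℝ ; _≈_ = _≈_ ; _≤_ = _≤_
  ; isPartialOrder = record
    { isPreorder = record
      { isEquivalence = record { refl = ≈-refl ; sym = ≈-sym ; trans = ≈-trans }
      ; reflexive = ≈⇒≤ ; trans = ≤-trans }
    ; antisym = ≤-antisym } }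

+-mono-≤ : w ≤ x → y ≤ z → w + y ≤ x + z
+-mono-≤ {w} {x} {y} {z} (mk≤ f) (mk≤ g) = mk≤ λ ε 0<ε →
  let M , p = f (½ ℚ.* ε) (0<½* 0<ε)
      N , q = g (½ ℚ.* ε) (0<½* 0<ε)
  in M ℕ.⊔ N , λ i h → begin
    seq w i ℚ.+ seq y i
      ≤⟨ ℚ.+-mono-≤ (p i (ℕ.m⊔n≤o⇒m≤o M N h)) (q i (ℕ.m⊔n≤o⇒n≤o M N h)) ⟩
    (seq x i ℚ.+ ½ ℚ.* ε) ℚ.+ (seq z i ℚ.+ ½ ℚ.* ε)
      ≡⟨ solve 3 (λ a b h → (a :+ h) :+ (b :+ h) := (a :+ b) :+ (h :+ h))
           refl (seq x i) (seq z i) (½ ℚ.* ε) ⟩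
    (seq x i ℚ.+ seq z i) ℚ.+ (½ ℚ.* ε ℚ.+ ½ ℚ.* ε)
      ≡⟨ cong ((seq x i ℚ.+ seq z i) ℚ.+_) (½+½ ε) ⟩
    (seq x i ℚ.+ seq z i) ℚ.+ ε ∎
  where
  open ℚ.≤-Reasoning
  open ℚ.+-*-Solver using (solve; _:=_; _:+_)

+-cancelʳ-≤ : ∀ z → x + z ≤ y + z → x ≤ y
+-cancelʳ-≤ {x} {y} z (mk≤ f) = mk≤ λ ε 0<ε → let N , p = f ε 0<ε in
  N , λ i h → subst₂ ℚ._≤_
    (solve 2 (λ x z → (x :+ z) :- z := x) refl (seq x i) (seq z i))
    (solve 3 (λ y z e → ((y :+ z) :+ e) :- z := y :+ e) refl (seq y i) (seq z i) ε)
    (ℚ.+-monoˡ-≤ (ℚ.- seq z i) (p i h))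
  where open ℚ.+-*-Solver

+-cong : w ≈ x → y ≈ z → w + y ≈ x + z
+-cong p q = ≤-antisym (+-mono-≤ (≈⇒≤ p) (≈⇒≤ q)) (+-mono-≤ (≈⇒≤ (≈-sym p)) (≈⇒≤ (≈-sym q)))

+-assoc : ∀ x y z → (x + y) + z ≈ x + (y + z)
+-assoc x y z = pointwise-≈ λ i → ℚ.+-assoc (seq x i) (seq y i) (seq z i)

+-identityˡ : ∀ x → 0ℝ + x ≈ x
+-identityˡ x = pointwise-≈ λ i → ℚ.+-identityˡ (seq x i)

+-identityʳ : ∀ x → x + 0ℝ ≈ x
+-identityʳ x = pointwise-≈ λ i → ℚ.+-identityʳ (seq x i)

+-comm : ∀ x y → x + y ≈ y + x
+-comm x y = pointwise-≈ λ i → ℚ.+-comm (seq x i) (seq y i)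

+-0-isCommutativeMonoid : IsCommutativeMonoid _≈_ _+_ 0ℝ
+-0-isCommutativeMonoid = record
  { isMonoid = record
    { isSemigroup = record
      { isMagma = record { isEquivalence = Poset.isEquivalence ≤-poset ; ∙-cong = +-cong }
      ; assoc = +-assoc }
    ; identity = +-identityˡ , +-identityʳ }
  ; comm = +-comm }

open Summation +-0-isCommutativeMonoid

-- Square roots, their reciprocals and the inequality for one edge

seq-· : ∀ m x i → seq (m · x) i ≡ + m ℚ./ 1 ℚ.* seq x i
seq-· zero    x i = sym (ℚ.*-zeroˡ (seq x i))
seq-· (suc m) x i = begin
  seq x i ℚ.+ seq (m · x) i
    ≡⟨ cong (seq x i ℚ.+_) (seq-· m x i) ⟩
  seq x i ℚ.+ + m ℚ./ 1 ℚ.* seq x i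
    ≡⟨ cong (ℚ._+ + m ℚ./ 1 ℚ.* seq x i) (ℚ.*-identityˡ (seq x i)) ⟨
  1ℚ ℚ.* seq x i ℚ.+ + m ℚ./ 1 ℚ.* seq x i
    ≡⟨ ℚ.*-distribʳ-+ (seq x i) 1ℚ (+ m ℚ./ 1) ⟨
  (1ℚ ℚ.+ + m ℚ./ 1) ℚ.* seq x i
    ≡⟨ cong (ℚ._* seq x i) (/-+ 1 m 0) ⟩
  + suc m ℚ./ 1 ℚ.* seq x i ∎
  where open ≡-Reasoning

-- `√-pos` has bound 1 from index 0 on. Hence the bounds on `1/√` below hold at every index, and
-- `recip` never takes its default value at these terms.
1≤√-seq : ∀ m i → 1ℚ ℚ.≤ √-seq (suc m) i
1≤√-seq m i = Positive.above (√-pos m) i z≤n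

0<√-seq : ∀ m i → 0ℚ ℚ.< √-seq (suc m) i
0<√-seq m i = ℚ.<-≤-trans (ℚ.positive⁻¹ 1ℚ) (1≤√-seq m i)

0≤1/√ : ∀ m i → 0ℚ ℚ.≤ seq (1/√ m) i
0≤1/√ zero    i = ℚ.≤-refl
0≤1/√ (suc m) i = ℚ.<⇒≤ (recip-pos (0<√-seq m i))

1/√≤1 : ∀ m i → seq (1/√ m) i ℚ.≤ 1ℚ
1/√≤1 zero    i = ℚ.<⇒≤ (ℚ.positive⁻¹ 1ℚ)
1/√≤1 (suc m) i = recip-anti (ℚ.positive⁻¹ 1ℚ) (1≤√-seq m i)

√-seq-0 : ∀ i → √-seq 0 i ≡ 0ℚ
√-seq-0 i = ℚ.≤-antisym (/-mono 0 i 0 0 z≤n) (/-mono 0 0 0 i z≤n)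

-- √ m − m / √ m = (√ m · √ m − m) / √ m, and 1 / √ m ≤ 1.
m·1/√m≈√m : ∀ m → m · 1/√ m ≈ √ m
-- Degree 0 occurs for the one-vertex tree; the empty multiple is 0 and so is every approximation of
-- `√ 0`.
m·1/√m≈√m zero    = pointwise-≈ (sym ∘ √-seq-0)
m·1/√m≈√m (suc m) = ≈-sym (mk≈ λ ε 0<ε →
  let N , p = _≈_.near (√-sq (suc m)) ε 0<ε in N , λ i h →
  let s = √-seq (suc m) i ; r = recip s in begin
    ∣ s ℚ.- seq (suc m · 1/√ suc m) i ∣
      ≡⟨ cong (λ t → ∣ s ℚ.- t ∣) (seq-· (suc m) (1/√ suc m) i) ⟩
    ∣ s ℚ.- M ℚ.* r ∣
      ≡⟨ cong ∣_∣ (split s r (*-recip (0<√-seq m i))) ⟩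
    ∣ r ℚ.* (s ℚ.* s ℚ.- M) ∣
      ≡⟨ ℚ.∣p*q∣≡∣p∣*∣q∣ r (s ℚ.* s ℚ.- M) ⟩
    ∣ r ∣ ℚ.* ∣ s ℚ.* s ℚ.- M ∣
      ≡⟨ cong (ℚ._* ∣ s ℚ.* s ℚ.- M ∣) (ℚ.0≤p⇒∣p∣≡p (0≤1/√ (suc m) i)) ⟩
    r ℚ.* ∣ s ℚ.* s ℚ.- M ∣
      ≤⟨ *-mono-≤ (0≤1/√ (suc m) i) (ℚ.<⇒≤ 0<ε) (1/√≤1 (suc m) i) (p i h) ⟩
    1ℚ ℚ.* ε
      ≡⟨ ℚ.*-identityˡ ε ⟩
    ε ∎)
  where
  open ℚ.≤-Reasoning
  M = + suc m ℚ./ 1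
  split : ∀ s r → s ℚ.* r ≡ 1ℚ → s ℚ.- M ℚ.* r ≡ r ℚ.* (s ℚ.* s ℚ.- M)
  split s r sr≡1 = begin-equality
    s ℚ.- M ℚ.* r             ≡⟨ cong (ℚ._- M ℚ.* r) (ℚ.*-identityʳ s) ⟨
    s ℚ.* 1ℚ ℚ.- M ℚ.* r      ≡⟨ cong (λ t → s ℚ.* t ℚ.- M ℚ.* r) sr≡1 ⟨
    s ℚ.* (s ℚ.* r) ℚ.- M ℚ.* r
      ≡⟨ solve 3 (λ s r m → s :* (s :* r) :- m :* r := r :* (s :* s :- m)) refl s r M ⟩
    r ℚ.* (s ℚ.* s ℚ.- M)     ∎
    where open ℚ.+-*-Solver using (solve; _:=_; _:*_; _:-_)

-- Otherwise squaring gives a contradiction: `r * r` is at most `a * b * k * k`, while `suc p` and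
-- `suc q` exceed the roots that `p` and `q` round down.
isqrt-* : ∀ a b k → isqrt ((a ℕ.* b) ℕ.* (k ℕ.* k)) ℕ.* k ℕ.≤
  suc (isqrt (a ℕ.* (k ℕ.* k))) ℕ.* suc (isqrt (b ℕ.* (k ℕ.* k)))
isqrt-* a b k = ℕ.≮⇒≥ λ h → ℕ.<-irrefl refl (begin-strict
    (suc p ℕ.* suc q) ℕ.* (suc p ℕ.* suc q)
      <⟨ ℕ.*-mono-< h h ⟩
    (r ℕ.* k) ℕ.* (r ℕ.* k)
      ≡⟨ solve 2 (λ r k → (r :* k) :* (r :* k) := (r :* r) :* (k :* k)) refl r k ⟩
    (r ℕ.* r) ℕ.* (k ℕ.* k)
      ≤⟨ ℕ.*-monoˡ-≤ (k ℕ.* k) (isqrt-lower ((a ℕ.* b) ℕ.* (k ℕ.* k))) ⟩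
    ((a ℕ.* b) ℕ.* (k ℕ.* k)) ℕ.* (k ℕ.* k)
      ≡⟨ solve 3 (λ a b k → ((a :* b) :* (k :* k)) :* (k :* k)
                         := (a :* (k :* k)) :* (b :* (k :* k))) refl a b k ⟩
    (a ℕ.* (k ℕ.* k)) ℕ.* (b ℕ.* (k ℕ.* k))
      ≤⟨ ℕ.*-mono-≤ (ℕ.<⇒≤ (isqrt-upper (a ℕ.* (k ℕ.* k)))) (ℕ.<⇒≤ (isqrt-upper (b ℕ.* (k ℕ.* k)))) ⟩
    (suc p ℕ.* suc p) ℕ.* (suc q ℕ.* suc q)
      ≡⟨ solve 2 (λ p q → (p :* p) :* (q :* q) := (p :* q) :* (p :* q)) refl (suc p) (suc q) ⟩
    (suc p ℕ.* suc q) ℕ.* (suc p ℕ.* suc q) ∎)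
  where
  open ℕ.≤-Reasoning
  open +-*-Solver using (solve; _:=_; _:*_)
  p = isqrt (a ℕ.* (k ℕ.* k))
  q = isqrt (b ℕ.* (k ℕ.* k))
  r = isqrt ((a ℕ.* b) ℕ.* (k ℕ.* k))

-- A crude bound from `m < suc m * suc m`. It keeps rounding errors linear in the denominator
-- `suc k`, so they vanish after division by its square.
isqrt-bound : ∀ m k → isqrt (m ℕ.* (suc k ℕ.* suc k)) ℕ.< suc m ℕ.* suc k
isqrt-bound m i = sq-cancel-< (ℕ.≤-<-trans (isqrt-lower (m ℕ.* (suc i ℕ.* suc i)))
  (subst (m ℕ.* (suc i ℕ.* suc i) ℕ.<_)
    (solve 2 (λ a k → (a :* a) :* (k :* k) := (a :* k) :* (a :* k)) refl (suc m) (suc i))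
    (ℕ.*-monoˡ-< (suc i ℕ.* suc i) (ℕ.m≤m*n (suc m) (suc m)))))
  where open +-*-Solver

-- The approximations are rounded down and need not multiply exactly. By `isqrt-*` the error
-- numerator over `k * k` is at most `e`, the excess of `suc p * suc q` over `p * q`.
√-submultiplicative : ∀ a b → √ (a ℕ.* b) ≤ √ a * √ b
√-submultiplicative a b = mk≤ λ ε 0<ε →
  let N , h = archimedean ε 0<ε
  -- By `isqrt-bound`, `e` is at most `c * k`, so the error is at most `c / k`, which is below
  -- `1 / suc N` from this index on.
  in c ℕ.* suc N , λ i c≤i →
  let k = suc i
      p = isqrt (a ℕ.* (k ℕ.* k))
      q = isqrt (b ℕ.* (k ℕ.* k))
      r = isqrt ((a ℕ.* b) ℕ.* (k ℕ.* k))
      e = suc p ℕ.+ q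
      kk-1 = i ℕ.+ i ℕ.* k
      r≤ : r ℕ.* (k ℕ.* k) ℕ.≤ (p ℕ.* q ℕ.+ e) ℕ.* k
      r≤ = subst₂ ℕ._≤_ (ℕ.*-assoc r k k)
        (cong (ℕ._* k) (solve 2 (λ p q → (con 1 :+ p) :* (con 1 :+ q)
                          := p :* q :+ ((con 1 :+ p) :+ q)) refl p q))
        (ℕ.*-monoˡ-≤ k (isqrt-* a b k))
      e≤ : e ℕ.* suc N ℕ.≤ 1 ℕ.* (k ℕ.* k)
      e≤ = ℕ.≤-trans
        (ℕ.*-monoˡ-≤ (suc N) (ℕ.+-mono-≤ (isqrt-bound a i) (ℕ.<⇒≤ (isqrt-bound b i))))
        (subst₂ ℕ._≤_
          (solve 4 (λ a b n k → ((a :+ b) :* n) :* k := (a :* k :+ b :* k) :* n)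
             refl (suc a) (suc b) (suc N) k)
          (sym (ℕ.*-identityˡ (k ℕ.* k)))
          (ℕ.*-monoˡ-≤ k (ℕ.≤-trans c≤i (ℕ.n≤1+n i))))
  in begin
    + r ℚ./ k
      ≤⟨ /-mono r i (p ℕ.* q ℕ.+ e) kk-1 r≤ ⟩
    + (p ℕ.* q ℕ.+ e) ℚ./ (k ℕ.* k)
      ≡⟨ /-+ (p ℕ.* q) e kk-1 ⟨
    + (p ℕ.* q) ℚ./ (k ℕ.* k) ℚ.+ + e ℚ./ (k ℕ.* k)
      ≤⟨ ℚ.+-mono-≤ (ℚ.≤-reflexive (sym (/-* p i q i))) (ℚ.≤-trans (/-mono e kk-1 1 N e≤) h) ⟩
    √-seq a i ℚ.* √-seq b i ℚ.+ ε ∎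
  where
  open ℚ.≤-Reasoning
  open +-*-Solver using (solve; _:=_; _:*_; _:+_; con)
  c = suc a ℕ.+ suc b

-- Multiplying the last hypothesis by `ρ`, the product of the three reciprocals, leaves the error
-- `ρ * ε`, and `ρ` is at most 1.
recip-*-≤ : ∀ {p q r ε} → 0ℚ ℚ.≤ ε → 1ℚ ℚ.≤ p → 1ℚ ℚ.≤ q → 1ℚ ℚ.≤ r → r ℚ.≤ p ℚ.* q ℚ.+ ε →
            recip p ℚ.* recip q ℚ.≤ recip r ℚ.+ ε
recip-*-≤ {p} {q} {r} {ε} 0≤ε 1≤p 1≤q 1≤r r≤ = begin
  p′ ℚ.* q′                       ≡⟨ ℚ.*-identityʳ (p′ ℚ.* q′) ⟨
  p′ ℚ.* q′ ℚ.* 1ℚ                ≡⟨ cong (p′ ℚ.* q′ ℚ.*_) (*-recip (0< 1≤r)) ⟨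
  p′ ℚ.* q′ ℚ.* (r ℚ.* r′)        ≡⟨ solve 4 (λ p q r s → p :* q :* (r :* s) := p :* q :* s :* r)
                                       refl p′ q′ r r′ ⟩
  ρ ℚ.* r                         ≤⟨ ℚ.*-monoˡ-≤-nonNeg ρ {{ℚ.nonNegative 0≤ρ}} r≤ ⟩
  ρ ℚ.* (p ℚ.* q ℚ.+ ε)           ≡⟨ solve 6 (λ p q s x y e →
                                       x :* y :* s :* (p :* q :+ e)
                                       := (p :* x) :* ((q :* y) :* s) :+ x :* y :* s :* e)
                                       refl p q r′ p′ q′ ε ⟩
  (p ℚ.* p′) ℚ.* ((q ℚ.* q′) ℚ.* r′) ℚ.+ ρ ℚ.* ε
    ≡⟨ cong₂ (λ s t → s ℚ.* (t ℚ.* r′) ℚ.+ ρ ℚ.* ε) (*-recip (0< 1≤p)) (*-recip (0< 1≤q)) ⟩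
  1ℚ ℚ.* (1ℚ ℚ.* r′) ℚ.+ ρ ℚ.* ε  ≡⟨ cong (ℚ._+ ρ ℚ.* ε) (trans (ℚ.*-identityˡ _) (ℚ.*-identityˡ r′)) ⟩
  r′ ℚ.+ ρ ℚ.* ε                  ≤⟨ ℚ.+-monoʳ-≤ r′ (ℚ.*-monoʳ-≤-nonNeg ε {{ℚ.nonNegative 0≤ε}} ρ≤1) ⟩
  r′ ℚ.+ 1ℚ ℚ.* ε                 ≡⟨ cong (r′ ℚ.+_) (ℚ.*-identityˡ ε) ⟩
  r′ ℚ.+ ε                        ∎
  where
  open ℚ.≤-Reasoning
  open ℚ.+-*-Solver using (solve; _:=_; _:*_; _:+_)
  p′ = recip p
  q′ = recip q
  r′ = recip r
  ρ = p′ ℚ.* q′ ℚ.* r′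
  0<1 = ℚ.positive⁻¹ 1ℚ

  0< : ∀ {s} → 1ℚ ℚ.≤ s → 0ℚ ℚ.< s
  0< = ℚ.<-≤-trans 0<1

  0≤recip : ∀ {s} → 1ℚ ℚ.≤ s → 0ℚ ℚ.≤ recip s
  0≤recip 1≤s = ℚ.<⇒≤ (recip-pos (0< 1≤s))

  0≤ρ : 0ℚ ℚ.≤ ρ
  0≤ρ = ℚ.<⇒≤ (*-pos (*-pos (recip-pos (0< 1≤p)) (recip-pos (0< 1≤q))) (recip-pos (0< 1≤r)))

  recip≤1 : ∀ {s} → 1ℚ ℚ.≤ s → recip s ℚ.≤ 1ℚ
  recip≤1 = recip-anti 0<1

  ρ≤1 : ρ ℚ.≤ 1ℚ
  ρ≤1 = *-mono-≤ (ℚ.<⇒≤ (*-pos (recip-pos (0< 1≤p)) (recip-pos (0< 1≤q)))) (ℚ.<⇒≤ 0<1)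
    (*-mono-≤ (0≤recip 1≤p) (ℚ.<⇒≤ 0<1) (recip≤1 1≤p) (recip≤1 1≤q)) (recip≤1 1≤r)

recip-√-seq-* : ∀ a b ε → 0ℚ ℚ.< ε → ∃ λ N → ∀ i → N ℕ.≤ i →
  recip (√-seq (suc a) i) ℚ.* recip (√-seq (suc b) i) ℚ.≤
  recip (√-seq (suc a ℕ.* suc b) i) ℚ.+ ε
recip-√-seq-* a b ε 0<ε =
  let N , h = _≤_.below (√-submultiplicative (suc a) (suc b)) ε 0<ε
  in N , λ i N≤i →
    recip-*-≤ {√-seq (suc a) i} {√-seq (suc b) i} {√-seq (suc a ℕ.* suc b) i} {ε} (ℚ.<⇒≤ 0<ε)
      -- `b + a * suc b` is the predecessor of `suc a * suc b`.
      (1≤√-seq a i) (1≤√-seq b i) (1≤√-seq (b ℕ.+ a ℕ.* suc b) i) (h i N≤i)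

x*1/√0≤1/√m : ∀ x m → x * 1/√ zero ≤ 1/√ m
x*1/√0≤1/√m x m = pointwise-≤ λ i →
  ℚ.≤-trans (ℚ.≤-reflexive (ℚ.*-zeroʳ (seq x i))) (0≤1/√ m i)

1/√-submultiplicative : ∀ a b → 1/√ a * 1/√ b ≤ 1/√ (a ℕ.* b)
1/√-submultiplicative zero    b       = pointwise-≤ λ i →
  ℚ.≤-reflexive (ℚ.*-zeroˡ (seq (1/√ b) i))
1/√-submultiplicative (suc a) zero    = x*1/√0≤1/√m (1/√ suc a) (suc a ℕ.* zero)
1/√-submultiplicative (suc a) (suc b) = mk≤ (recip-√-seq-* a b)

-- At every index `(1 - x) * (1 - y)` is nonnegative for the approximations `x` and `y` of the two
-- reciprocal roots. Expanding gives `x + y` at most `1 + x * y`, and submultiplicativity replaces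
-- the product by the reciprocal root of `a * b`.
1/√-sum-≤ : ∀ a b → 1/√ a + 1/√ b ≤ 1ℝ + 1/√ (a ℕ.* b)
1/√-sum-≤ a b = ≤-trans {y = 1ℝ + 1/√ a * 1/√ b}
  (pointwise-≤ λ i → 0≤q-p⇒p≤q (subst (0ℚ ℚ.≤_)
    (solve 2 (λ x y → (con 1ℚ :- x) :* (con 1ℚ :- y) := (con 1ℚ :+ x :* y) :- (x :+ y))
       refl (seq (1/√ a) i) (seq (1/√ b) i))
    (*-mono-≤ ℚ.≤-refl (0≤1- b i) (0≤1- a i) (0≤1- b i))))
  (+-mono-≤ {1ℝ} {1ℝ} {1/√ a * 1/√ b} {1/√ (a ℕ.* b)} (≈⇒≤ ≈-refl) (1/√-submultiplicative a b))
  where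
  open ℚ.+-*-Solver
  0≤1- : ∀ m i → 0ℚ ℚ.≤ 1ℚ ℚ.- seq (1/√ m) i
  0≤1- m i = subst (ℚ._≤ 1ℚ ℚ.- seq (1/√ m) i) (ℚ.+-inverseʳ (seq (1/√ m) i))
    (ℚ.+-monoˡ-≤ (ℚ.- seq (1/√ m) i) (1/√≤1 m i))

-- The case `m = 1` of `m·1/√m≈√m`, since the approximations of `√ 1` are all exactly 1.
1/√1≈1 : 1/√ 1 ≈ 1ℝ
1/√1≈1 = ≈-trans (≈-sym (pointwise-≈ λ i → ℚ.+-identityʳ (seq (1/√ 1) i)))
  (≈-trans (m·1/√m≈√m 1) (pointwise-≈ √-seq-1))
  where
  √-seq-1 : ∀ i → √-seq 1 i ≡ 1ℚ
  √-seq-1 i = ℚ.≤-antisym (/-mono r i 1 0 (subst₂ ℕ._≤_ (sym (ℕ.*-identityʳ r)) (sym (ℕ.*-identityˡ k)) r≤k))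
                          (1≤√-seq 0 i)
    where
    k = suc i
    r = isqrt (1 ℕ.* (k ℕ.* k))
    r≤k : r ℕ.≤ k
    r≤k = ℕ.≮⇒≥ λ k<r → ℕ.<⇒≱ (ℕ.*-mono-< k<r k<r)
      (subst (r ℕ.* r ℕ.≤_) (ℕ.*-identityˡ (k ℕ.* k)) (isqrt-lower (1 ℕ.* (k ℕ.* k))))

x≈1⇒x+y≈1+z : x ≈ 1ℝ → y ≡ z → x + y ≈ 1ℝ + z
x≈1⇒x+y≈1+z {x} {y} x≈1 refl = +-cong {x} {1ℝ} {y} {y} x≈1 ≈-refl

-- The equality case of `1/√-sum-≤`: the argument 1 contributes the summand 1, and the product
-- `a * b` is the other argument.
1/√-sum-≈ : ∀ a b → a ≡ 1 ⊎ b ≡ 1 → 1/√ a + 1/√ b ≈ 1ℝ + 1/√ (a ℕ.* b)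
1/√-sum-≈ a b (inj₁ a≡1) = x≈1⇒x+y≈1+z {1/√ a} {1/√ b} {1/√ (a ℕ.* b)}
  (subst (λ m → 1/√ m ≈ 1ℝ) (sym a≡1) 1/√1≈1)
  (cong 1/√_ (sym (trans (cong (ℕ._* b) a≡1) (ℕ.*-identityˡ b))))
1/√-sum-≈ a b (inj₂ b≡1) = ≈-trans (+-comm (1/√ a) (1/√ b))
  (x≈1⇒x+y≈1+z {1/√ b} {1/√ a} {1/√ (a ℕ.* b)}
    (subst (λ m → 1/√ m ≈ 1ℝ) (sym b≡1) 1/√1≈1)
    (cong 1/√_ (sym (trans (cong (a ℕ.*_) b≡1) (ℕ.*-identityʳ a)))))

x≈x-1+1 : ∀ x → x ≈ (x - 1ℝ) + 1ℝ
x≈x-1+1 x = pointwise-≈ λ i → solve 2 (λ p q → p := (p :- q) :+ q) refl (seq x i) 1ℚ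
  where open ℚ.+-*-Solver

m·1/√m≈√m-1+1 : ∀ m → m · 1/√ m ≈ (√ m - 1ℝ) + 1ℝ
m·1/√m≈√m-1+1 m = ≈-trans (m·1/√m≈√m m) (x≈x-1+1 (√ m))

-- The lower bound for trees and the upper bound for stars

module _ {n : ℕ} (G : Graph n) (tree : IsTree G) where
  private
    module Bounds = TreeSum (Poset.isPartialOrder ≤-poset) +-mono-≤ +-cancelʳ-≤ G tree
      1ℝ (λ v → 1/√ degree G v) (λ v → √ degree G v - 1ℝ)
      (λ (u , v) → 1/√ (degree G u ℕ.* degree G v))
      (sumℝ (map (λ v → √ degree G v - 1ℝ) (allFin n))) (randić G) refl refl
      (λ v → m·1/√m≈√m-1+1 (degree G v))

  randić-lower : 1ℝ + sumℝ (map (λ v → √ degree G v - 1ℝ) (allFin n)) ≤ randić G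
  randić-lower = Bounds.vertex-∑≲edge-∑ λ u v _ → 1/√-sum-≤ (degree G u) (degree G v)

  randić-star-upper : IsStar G → randić G ≤ 1ℝ + sumℝ (map (λ v → √ degree G v - 1ℝ) (allFin n))
  randić-star-upper star = Bounds.edge-∑≲vertex-∑ λ u v e →
    ≈⇒≤ (≈-sym (1/√-sum-≈ (degree G u) (degree G v) (star-edge G star e)))

theorem4p1 : ∀ {n : ℕ} (G : Graph n) → IsTree G →
    (randić G ≥ 1ℝ + sumℝ (map (λ v → √ degree G v - 1ℝ) (allFin n))) ×
    (IsStar G → randić G ≈ 1ℝ + sumℝ (map (λ v → √ degree G v - 1ℝ) (allFin n)))
theorem4p1 G tree = randić-lower G tree ,
  λ star → ≤-antisym (randić-star-upper G tree star) (randić-lower G tree)
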